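{- Let $n\ge2$ be even and $z\in\tilde I^{\mathsf{FPF}}_n$. Then $\ell(w)=\hat\ell_{\mathsf{FPF}}(z)$ for all $w\in\mathcal A^{\mathsf{FPF}}(z)$, and $\{\alpha^{\mathsf{FPF}}_{\min}(z),\alpha^{\mathsf{FPF}}_{\max}(z)\}\subset\mathcal A^{\mathsf{FPF}}(z)$.
   Context: $\tilde S_n$ is the group of bijections $\pi:\mathbb Z\to\mathbb Z$ with $\pi(i+n)=\pi(i)+n$ and $\sum_{i=1}^n\pi(i)=\sum_{i=1}^n i$, a Coxeter group with generators $s_1,\dots,s_n$ ($s_i$ swaps $i+kn,i+1+kn$ for all $k$) and length $\ell$. $\tilde I^{\mathsf{FPF}}_n$ is the set of $z\in\tilde S_n$ with $z(z(i))=i\ne z(i)$ for all $i$. With $\Theta^+=s_1s_3\cdots s_{n-1}$, $\Theta^-=s_2s_4\cdots s_n$, each $z\in\tilde I^{\mathsf{FPF}}_n$ is conjugate to exactly one $\Theta\in\{\Theta^\pm\}$, and $\mathcal A^{\mathsf{FPF}}(z)$ is the set of minimal-length elements of $\{w\in\tilde S_n:w^{ -1}\Theta w=z\}$. $\hat\ell_{\mathsf{FPF}}(z)=\frac12(\ell(z)-\frac n2)$. Window notation: for integers $c_1,\dots,c_n$ representing each residue class mod $n$ exactly once, $[c_1,\dots,c_n]$ denotes the unique $\pi\in\tilde S_n$ such that $\pi(m+k)=c_k$ for $k=1,\dots,n$ for some $m\in\mathbb Z$. Let $l=n/2$, let $a_1<\dots<a_l$ be the $a\in\{1,\dots,n\}$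 with $a<z(a)$, $b_i=z(a_i)$; let $d_1<\dots<d_l$ be the $d\in\{1,\dots,n\}$ with $z(d)<d$, $c_i=z(d_i)$. Then $\alpha^{\mathsf{FPF}}_{\min}(z)=[a_1,b_1,a_2,b_2,\dots,a_l,b_l]^{ -1}$ and $\alpha^{\mathsf{FPF}}_{\max}(z)=[c_1,d_1,\dots,c_l,d_l]^{ -1}$. -}

module Defs where

open import Data.Nat as ℕ using (ℕ; zero; suc; _≤_)
open import Data.Nat.DivMod using (_/_)
open import Data.Integer as ℤ using (ℤ; +_; _+_; _-_; _<?_)
open import Data.Integer.DivMod using (_%ℕ_)
open import Data.Fin using (Fin; toℕ)
open import Data.List using (List; []; _∷_; map; upTo; filter; concatMap; length; lookup)
open import Data.Product using (Σ; ∃; _×_; _,_)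
open import Data.Sum using (_⊎_)
open import Data.Bool using (if_then_else_)
open import Relation.Binary.PropositionalEquality using (_≡_; _≢_)
open import Relation.Nullary using (does)

modN : ℤ → ℕ → ℕ
modN j zero    = 0
modN j (suc m) = j %ℕ suc m

sumTo : (ℕ → ℤ) → ℕ → ℤ
sumTo f zero    = + 0
sumTo f (suc m) = sumTo f m + f (suc m)

_≈_ : (ℤ → ℤ) → (ℤ → ℤ) → Set
f ≈ g = ∀ i → f i ≡ g i

record AffPerm (n : ℕ) : Set where
  field
    fun       : ℤ → ℤ
    inv       : ℤ → ℤ
    inv-fun   : ∀ i → inv (fun i) ≡ i
    fun-inv   : ∀ i → fun (inv i) ≡ i
    periodic  : ∀ i → fun (i + + n) ≡ fun i + + n
    sum-cond  : sumTo (λ i → fun (+ i)) n ≡ sumTo (λ i → + i) n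
open AffPerm public

-- The generator s_i (i : ℕ; used for i = 1,…,n): it swaps i + tn and
-- i + 1 + tn for all t ∈ ℤ, fixing all other integers.
genℕ : (n : ℕ) → ℕ → ℤ → ℤ
genℕ n i j =
  if does (modN (j - + i) n ℕ.≟ 0) then j + + 1
  else if does (modN (j - + i) n ℕ.≟ 1) then j - + 1
  else j

prodℕ : (n : ℕ) → List ℕ → ℤ → ℤ
prodℕ n []       j = j
prodℕ n (i ∷ is) j = genℕ n i (prodℕ n is j)

prod : (n : ℕ) → List (Fin n) → ℤ → ℤ
prod n ws = prodℕ n (map (λ k → suc (toℕ k)) ws)

HasLength : (n : ℕ) → (ℤ → ℤ) → ℕ → Set
HasLength n f k =
  (Σ (List (Fin n)) λ ws → (length ws ≡ k) × (f ≈ prod n ws))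
  × (∀ (ws : List (Fin n)) → f ≈ prod n ws → k ≤ length ws)

Θ⁺ : ℕ → ℤ → ℤ
Θ⁺ n = prodℕ n (map (λ t → 1 ℕ.+ 2 ℕ.* t) (upTo (n ℕ./ 2)))

Θ⁻ : ℕ → ℤ → ℤ
Θ⁻ n = prodℕ n (map (λ t → 2 ℕ.+ 2 ℕ.* t) (upTo (n ℕ./ 2)))

IsFPFInvolution : {n : ℕ} → AffPerm n → Set
IsFPFInvolution z = ∀ i → (fun z (fun z i) ≡ i) × (fun z i ≢ i)

Conj : {n : ℕ} → (ℤ → ℤ) → AffPerm n → AffPerm n → Set
Conj Θ w z = ∀ i → inv w (Θ (fun w i)) ≡ fun z i

MinConj : (n : ℕ) → (ℤ → ℤ) → AffPerm n → AffPerm n → Set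
MinConj n Θ z w =
  Conj Θ w z ×
  (Σ ℕ λ k → HasLength n (fun w) k ×
     (∀ (w' : AffPerm n) → Conj Θ w' z → ∀ k' → HasLength n (fun w') k' → k ℕ.≤ k'))

-- w ∈ A^FPF(z), where Θ ∈ {Θ⁺, Θ⁻} is the one that z is conjugate to
-- (exactly one of them is, so quantifying over both is equivalent).
InAFPF : (n : ℕ) → AffPerm n → AffPerm n → Set
InAFPF n z w = MinConj n (Θ⁺ n) z w ⊎ MinConj n (Θ⁻ n) z w

-- ℓ̂_FPF(z) = k, i.e. k = (ℓ(z) - n/2)/2, i.e. ℓ(z) = 2k + n/2
HasHatLengthFPF : (n : ℕ) → AffPerm n → ℕ → Set
HasHatLengthFPF n z k = HasLength n (fun z) (2 ℕ.* k ℕ.+ n ℕ./ 2)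

HasWindow : (ℤ → ℤ) → List ℤ → Set
HasWindow π cs = Σ ℤ λ m → ∀ (k : Fin (length cs)) → π (m + + suc (toℕ k)) ≡ lookup cs k

aList : {n : ℕ} → AffPerm n → List ℕ
aList {n} z = filter (λ a → + a <? fun z (+ a)) (map suc (upTo n))

dList : {n : ℕ} → AffPerm n → List ℕ
dList {n} z = filter (λ d → fun z (+ d) <? + d) (map suc (upTo n))

minWindow : {n : ℕ} → AffPerm n → List ℤ
minWindow z = concatMap (λ a → + a ∷ fun z (+ a) ∷ []) (aList z)

maxWindow : {n : ℕ} → AffPerm n → List ℤ
maxWindow z = concatMap (λ d → fun z (+ d) ∷ + d ∷ []) (dList z)

IsαMin : {n : ℕ} → AffPerm n → AffPerm n → Set
IsαMin z w = HasWindow (inv w) (minWindow z)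

IsαMax : {n : ℕ} → AffPerm n → AffPerm n → Set
IsαMax z w = HasWindow (inv w) (maxWindow z)

{-# OPTIONS --safe #-}
module Submission where

-- Put D(a) = ⌊a / n⌋.  Twice the length of f is ‖ f ‖, the sum over ordered pairs (x , y) of
-- residues of |D(f y - f x) - D(y - x)|: this is a distance from f to the identity which is
-- invariant under reindexing, each generator has norm 2, and left multiplication by a generator
-- at a descent of f⁻¹ lowers the norm by 2.  The triangle inequality for z = w⁻¹Θw then gives
-- ℓ(z) ≤ 2ℓ(w) + n/2.  The minimal and maximal atoms both send the cycles of z to consecutive
-- blocks of size two, and comparing inversions cycle by cycle shows equality for them.  Finally
-- Θ⁺ and Θ⁻ are not conjugate: a permutation commuting with Θ⁺ has ∑ (t(i) - i) divisible by 2n,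
-- while the translation by one, which conjugates Θ⁺ to Θ⁻, contributes n.

open import Defs renaming (_≈_ to _≗ℤ_)
open import Algebra.Bundles using (module AbelianGroup; CommutativeMonoid)
import Algebra.Properties.CommutativeMonoid.Sum as MonoidSum
import Algebra.Properties.Semiring.Sum as SemiringSum
open import Data.Bool using (Bool; true; false; not; _xor_; if_then_else_)
open import Data.Bool.Properties using (not-involutive)
open import Data.Fin as Fin using (Fin; toℕ; fromℕ<)
open import Data.Fin.Permutation using (Permutation; permutation)
import Data.Fin.Properties as FinP
open import Data.Integer as ℤ using (ℤ; +_; -[1+_]; _+_; _-_; _*_; -_; _≤_; _<_; ∣_∣)
open import Data.Integer.DivMod using (_/ℕ_; _%ℕ_; [n/ℕd]*d≤n; n<s[n/ℕd]*d; a≡a%ℕn+[a/ℕn]*n; n%ℕd<d)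
import Data.Integer.Properties as ℤP
import Algebra.Properties.Group (AbelianGroup.group ℤP.+-0-abelianGroup) as ℤG
open import Data.Integer.Tactic.RingSolver using (solve-∀)
open import Data.List using (List; []; _∷_; length; map; upTo; applyUpTo; filter; concatMap; lookup)
import Data.List.Properties as ListP
open import Data.List.Membership.Propositional using (_∈_)
open import Data.List.Membership.Propositional.Properties using (∈-upTo⁺; ∈-upTo⁻)
open import Data.List.Relation.Unary.All as All using (All; []; _∷_)
open import Data.List.Relation.Unary.AllPairs using (_∷_)
open import Data.List.Relation.Unary.Any using (here; there)
open import Data.List.Relation.Unary.Unique.Propositional using (Unique)
open import Data.List.Relation.Unary.Unique.Propositional.Properties using (upTo⁺)
open import Data.Nat as ℕ using (ℕ; zero; suc; NonZero)
open import Data.Nat.Divisibility using (_∣_; divides)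
open import Data.Nat.DivMod using (m*n/n≡m)
import Data.Nat.Properties as ℕP
import Data.Nat.Tactic.RingSolver as ℕS
open import Data.Product using (Σ; _×_; _,_; proj₁; proj₂)
open import Data.Sum as Sum using (_⊎_; inj₁; inj₂)
open import Function using (_∘_; id)
open import Level using (0ℓ)
open import Relation.Binary.Definitions using (tri<; tri≈; tri>)
open import Relation.Binary.PropositionalEquality
open import Relation.Nullary using (Dec; does; yes; no; ¬_; contradiction)
open import Relation.Nullary.Decidable using (map′; dec-true; dec-false)
open import Relation.Unary using (Decidable)

-- The triangle inequality bounds every conjugator from below and the two atoms attain the bound, so
-- their minimality and the common length of all elements of `InAFPF` come out together. Minimality
-- is only asserted among conjugators of one Θ, so an arbitrary w can be compared with an atom only
-- when both belong to the same Θ; this is why the non-conjugacy of Θ⁺ and Θ⁻ enters. The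
-- calculations take place in the group of all periodic bijections, because the translation by one
-- and the atoms as first constructed need not satisfy the sum condition. The norm sees only
-- differences of values, so an atom can afterwards be translated into the affine symmetric group at
-- no cost. An integer translation suffices because the total displacement is always a multiple of
-- n; its parity decides between Θ⁺ and Θ⁻, and it is absorbed by the free shift `m` in the window
-- notation. The equality of lengths is not an identity of single pairs of residues: only the sum
-- over the four pairs of entries of two cycles balances.

≤-by-difference : ∀ {a b i j} → a ≤ b → j - i ≡ b - a → i ≤ j
≤-by-difference {a} {b} {i} {j} a≤b eq =
  ℤP.0≤i-j⇒j≤i (subst (+ 0 ≤_) (sym eq) (ℤP.i≤j⇒0≤j-i a≤b))

<⇒1+≤ : ∀ {i j} → i < j → i + + 1 ≤ j
<⇒1+≤ {i} {j} i<j = subst (_≤ j) (ℤP.+-comm (+ 1) i) (ℤP.i<j⇒suc[i]≤j i<j)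

1+≤⇒< : ∀ {i j} → i + + 1 ≤ j → i < j
1+≤⇒< {i} {j} p = ℤP.suc[i]≤j⇒i<j (subst (_≤ j) (ℤP.+-comm i (+ 1)) p)

<-by-difference : ∀ {a b i j} → a < b → j - i ≡ b - a → i < j
<-by-difference {a} {b} {i} {j} a<b eq =
  1+≤⇒< (≤-by-difference (<⇒1+≤ a<b)
    (trans (shift j i) (trans (cong (_- + 1) eq) (sym (shift b a)))))
  where
  shift : ∀ x y → x - (y + + 1) ≡ x - y - + 1
  shift = solve-∀

<1+⇒≤ : ∀ {i j} → i < j + + 1 → i ≤ j
<1+⇒≤ {i} {j} p = ≤-by-difference (<⇒1+≤ p) (lemma i j)
  where
  lemma : ∀ i j → j - i ≡ j + + 1 - (i + + 1)
  lemma = solve-∀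

-- Floor division by n and multiples of n

module Affine (p : ℕ) where

  n : ℕ
  n = suc (suc p)

  N : ℤ
  N = + n

  opaque
    -- Opaque, so that everything later rests on the two bounds and the remainder decomposition,
    -- never on how integer division computes.
    D : ℤ → ℤ
    D a = a /ℕ n

    D-lower : ∀ a → D a * N ≤ a
    D-lower a = [n/ℕd]*d≤n a n

    D-upper : ∀ a → a < (D a + + 1) * N
    D-upper a = subst (λ t → a < t * N) (ℤP.+-comm (+ 1) (D a)) (n<s[n/ℕd]*d a n)

    %-decomposition : ∀ a → a ≡ + (a %ℕ n) + D a * N
    %-decomposition a = a≡a%ℕn+[a/ℕn]*n a n

  ≤D : ∀ {q a} → q * N ≤ a → q ≤ D a
  ≤D {q} {a} le = <1+⇒≤ (ℤP.*-cancelʳ-<-nonNeg N (ℤP.≤-<-trans le (D-upper a)))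

  D< : ∀ {q a} → a < q * N → D a < q
  D< {q} {a} lt = ℤP.*-cancelʳ-<-nonNeg N (ℤP.≤-<-trans (D-lower a) lt)

  D-mono : ∀ {a b} → a ≤ b → D a ≤ D b
  D-mono {a} a≤b = ≤D (ℤP.≤-trans (D-lower a) a≤b)

  D-unique : ∀ {q a} → q * N ≤ a → a < (q + + 1) * N → D a ≡ q
  D-unique lo hi = ℤP.≤-antisym (<1+⇒≤ (D< hi)) (≤D lo)

  D-shift : ∀ a t → D (a + t * N) ≡ D a + t
  D-shift a t = D-unique
    (≤-by-difference (D-lower a) (lower a (D a) t N))
    (<-by-difference (D-upper a) (upper a (D a) t N))
    where
    lower : ∀ a d t m → a + t * m - (d + t) * m ≡ a - d * m
    lower = solve-∀
    upper : ∀ a d t m → (d + t + + 1) * m - (a + t * m) ≡ (d + + 1) * m - a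
    upper = solve-∀

  D-small : ∀ {a} → + 0 ≤ a → a < N → D a ≡ + 0
  D-small {a} lo hi = D-unique lo (subst (a <_) (sym (ℤP.*-identityˡ N)) hi)

  residue : ∀ a → Σ ℕ λ r → r ℕ.< n × a ≡ + r + D a * N
  residue a = a %ℕ n , n%ℕd<d a n , %-decomposition a

  D-remainder : ∀ {r} t → r ℕ.< n → D (+ r + t * N) ≡ t
  D-remainder {r} t r<n = trans (D-shift (+ r) t)
    (trans (cong (_+ t) (D-small (ℤ.+≤+ ℕ.z≤n) (ℤ.+<+ r<n))) (ℤP.+-identityˡ t))

  %-unique : ∀ {a r} t → r ℕ.< n → a ≡ + r + t * N → a %ℕ n ≡ r
  %-unique {a} {r} t r<n eq = ℤP.+-injective (begin
    + (a %ℕ n)                     ≡⟨ cancel (+ (a %ℕ n)) (D a * N) ⟩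
    + (a %ℕ n) + D a * N - D a * N ≡⟨ cong (_- D a * N) (%-decomposition a) ⟨
    a - D a * N                    ≡⟨ cong₂ (λ x y → x - y * N) eq (trans (cong D eq) (D-remainder t r<n)) ⟩
    + r + t * N - t * N            ≡⟨ cancel (+ r) (t * N) ⟨
    + r                            ∎)
    where
    open ≡-Reasoning
    cancel : ∀ x y → x ≡ x + y - y
    cancel = solve-∀

  Multiple : ℤ → Set
  Multiple x = Σ ℤ λ t → x ≡ t * N

  multiple? : ∀ x → Dec (Multiple x)
  multiple? x = map′ to from (x %ℕ n ℕ.≟ 0)
    where
    to : x %ℕ n ≡ 0 → Multiple x
    to eq = D x , trans (%-decomposition x)
      (trans (cong (λ r → + r + D x * N) eq) (ℤP.+-identityˡ (D x * N)))
    from : Multiple x → x %ℕ n ≡ 0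
    from (t , eq) = %-unique t (ℕ.s≤s ℕ.z≤n) (trans eq (sym (ℤP.+-identityˡ (t * N))))

  opaque
    χ : ℤ → ℕ
    χ x = if does (multiple? x) then 1 else 0

    χ-yes : ∀ {x} → Multiple x → χ x ≡ 1
    χ-yes {x} m = cong (if_then 1 else 0) (dec-true (multiple? x) m)

    χ-no : ∀ {x} → ¬ Multiple x → χ x ≡ 0
    χ-no {x} m = cong (if_then 1 else 0) (dec-false (multiple? x) m)

  Multiple-difference : ∀ {x y} → Multiple x → Multiple y → Multiple (x - y)
  Multiple-difference (s , refl) (t , refl) = s - t , distrib s t N
    where
    distrib : ∀ s t m → s * m - t * m ≡ (s - t) * m
    distrib = solve-∀

  Multiple-sum : ∀ {x y} → Multiple x → Multiple y → Multiple (x + y)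
  Multiple-sum (s , refl) (t , refl) = s + t , sym (ℤP.*-distribʳ-+ N s t)

  small-not-multiple : ∀ {x} → + 0 < x → x < N → ¬ Multiple x
  small-not-multiple {x} 0<x x<n (t , eq) = ℤP.<-irrefl
    (sym (trans eq (trans (cong (_* N) t≡0) refl))) 0<x
    where
    t≡0 : t ≡ + 0
    t≡0 = trans (sym (D-remainder t (ℕ.s≤s ℕ.z≤n)))
      (trans (cong D (trans (ℤP.+-identityˡ (t * N)) (sym eq))) (D-small (ℤP.<⇒≤ 0<x) x<n))

  -- Periodic bijections of ℤ and sums over residues

  -- The period is a parameter because `monotone-translation` applies this with period one.
  periodic-multiple : ∀ s {A : Set} (g : ℤ → A) → (∀ x → g (x + s) ≡ g x) →
    ∀ x t → g (x + t * s) ≡ g x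
  periodic-multiple s g per x t = go t
    where
    forward : ∀ k x → g (x + + k * s) ≡ g x
    forward zero    x = cong g (ℤP.+-identityʳ x)
    forward (suc k) x = trans (cong g (split x (+ k) s)) (trans (per (x + + k * s)) (forward k x))
      where
      split : ∀ x k m → x + (+ 1 + k) * m ≡ x + k * m + m
      split = solve-∀
    go : ∀ t → g (x + t * s) ≡ g x
    go (+ k)    = forward k x
    go -[1+ k ] = trans (sym (forward (suc k) (x + -[1+ k ] * s))) (cong g (cancel x (+ suc k) s))
      where
      cancel : ∀ x k m → x + (- k) * m + k * m ≡ x
      cancel = solve-∀

  Equivariant : (ℤ → ℤ) → Set
  Equivariant f = ∀ x → f (x + N) ≡ f x + N

  -- Period and increment are kept apart because `rank` grows by `L` over a period `N`.
  shift-multiple : ∀ s u f → (∀ x → f (x + s) ≡ f x + u) → ∀ x t → f (x + t * s) ≡ f x + t * u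
  shift-multiple s u f shift x t = go t
    where
    forward : ∀ k x → f (x + + k * s) ≡ f x + + k * u
    forward zero    x = trans (cong f (ℤP.+-identityʳ x)) (sym (ℤP.+-identityʳ (f x)))
    forward (suc k) x = begin
      f (x + (+ 1 + + k) * s)   ≡⟨ cong f (split x (+ k) s) ⟩
      f (x + + k * s + s)       ≡⟨ shift (x + + k * s) ⟩
      f (x + + k * s) + u       ≡⟨ cong (_+ u) (forward k x) ⟩
      f x + + k * u + u         ≡⟨ split (f x) (+ k) u ⟨
      f x + (+ 1 + + k) * u     ∎
      where
      open ≡-Reasoning
      split : ∀ x k m → x + (+ 1 + k) * m ≡ x + k * m + m
      split = solve-∀
    go : ∀ t → f (x + t * s) ≡ f x + t * u
    go (+ k)    = forward k x
    go -[1+ k ] = begin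
      f (x + -[1+ k ] * s)                                      ≡⟨ cancel₁ (f (x + -[1+ k ] * s)) (+ suc k) u ⟩
      f (x + -[1+ k ] * s) + + suc k * u + -[1+ k ] * u         ≡⟨ cong (_+ -[1+ k ] * u) (forward (suc k) (x + -[1+ k ] * s)) ⟨
      f (x + -[1+ k ] * s + + suc k * s) + -[1+ k ] * u         ≡⟨ cong (λ y → f y + -[1+ k ] * u) (cancel₂ x (+ suc k) s) ⟩
      f x + -[1+ k ] * u                                        ∎
      where
      open ≡-Reasoning
      cancel₁ : ∀ a k m → a ≡ a + k * m + (- k) * m
      cancel₁ = solve-∀
      cancel₂ : ∀ x k m → x + (- k) * m + k * m ≡ x
      cancel₂ = solve-∀

  equivariant-multiple : ∀ f → Equivariant f → ∀ x t → f (x + t * N) ≡ f x + t * N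
  equivariant-multiple = shift-multiple N N

  -- The extended affine symmetric group: translations and unnormalised atoms belong to it. The sum
  -- condition reappears as vanishing `drift`.
  record Bijection : Set where
    field
      to      : ℤ → ℤ
      from    : ℤ → ℤ
      from-to : ∀ x → from (to x) ≡ x
      to-from : ∀ y → to (from y) ≡ y
      to-+N   : Equivariant to

    from-+N : Equivariant from
    from-+N y = begin
      from (y + N)               ≡⟨ cong (λ z → from (z + N)) (to-from y) ⟨
      from (to (from y) + N)     ≡⟨ cong from (to-+N (from y)) ⟨
      from (to (from y + N))     ≡⟨ from-to (from y + N) ⟩
      from y + N                 ∎
      where open ≡-Reasoning

    to-injective : ∀ {x y} → to x ≡ to y → x ≡ y
    to-injective {x} {y} eq = trans (sym (from-to x)) (trans (cong from eq) (from-to y))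

  open Bijection

  idᵇ : Bijection
  idᵇ = record { to = id ; from = id ; from-to = λ _ → refl ; to-from = λ _ → refl ; to-+N = λ _ → refl }

  infixr 9 _∘ᵇ_
  _∘ᵇ_ : Bijection → Bijection → Bijection
  f ∘ᵇ g = record
    { to      = to f ∘ to g
    ; from    = from g ∘ from f
    ; from-to = λ x → trans (cong (from g) (from-to f (to g x))) (from-to g x)
    ; to-from = λ y → trans (cong (to f) (to-from g (from f y))) (to-from f y)
    ; to-+N   = λ x → trans (cong (to f) (to-+N g x)) (to-+N f (to g x))
    }

  infix 10 _⁻¹ᵇ
  _⁻¹ᵇ : Bijection → Bijection
  f ⁻¹ᵇ = record { to = from f ; from = to f ; from-to = to-from f ; to-from = from-to f ; to-+N = from-+N f }

  translate : ℤ → Bijection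
  translate c = record
    { to      = _+ c
    ; from    = _- c
    ; from-to = λ x → lemma₁ x c
    ; to-from = λ x → lemma₂ x c
    ; to-+N   = λ x → lemma₃ x c N
    }
    where
    lemma₁ : ∀ x c → x + c - c ≡ x
    lemma₁ = solve-∀
    lemma₂ : ∀ x c → x - c + c ≡ x
    lemma₂ = solve-∀
    lemma₃ : ∀ x c m → x + m + c ≡ x + c + m
    lemma₃ = solve-∀

  -- Representatives run from 1 to n, matching both `sumTo` and the indices of the generators in
  -- `prod`.
  rep : Fin n → ℤ
  rep i = + suc (toℕ i)

  class : ℤ → Fin n
  class x = fromℕ< (n%ℕd<d (x - + 1) n)

  rep-class : ∀ x → rep (class x) ≡ x + (- D (x - + 1)) * N
  rep-class x = begin
    rep (class x)                     ≡⟨ cong (λ r → + suc r) (FinP.toℕ-fromℕ< (n%ℕd<d (x - + 1) n)) ⟩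
    + 1 + + r                         ≡⟨ lemma (+ r) d N ⟩
    + 1 + (+ r + d * N) + (- d) * N   ≡⟨ cong (λ y → + 1 + y + (- d) * N) (%-decomposition (x - + 1)) ⟨
    + 1 + (x - + 1) + (- d) * N       ≡⟨ cong (_+ (- d) * N) (lemma′ x) ⟩
    x + (- d) * N                     ∎
    where
    open ≡-Reasoning
    r = (x - + 1) %ℕ n
    d = D (x - + 1)
    lemma : ∀ r d m → + 1 + r ≡ + 1 + (r + d * m) + (- d) * m
    lemma = solve-∀
    lemma′ : ∀ x → + 1 + (x - + 1) ≡ x
    lemma′ = solve-∀

  class-rep : ∀ i t → class (rep i + t * N) ≡ i
  class-rep i t = FinP.toℕ-injective (trans (FinP.toℕ-fromℕ< (n%ℕd<d (rep i + t * N - + 1) n))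
    (%-unique t (FinP.toℕ<n i) (lemma (+ toℕ i) (t * N))))
    where
    lemma : ∀ r u → + 1 + r + u - + 1 ≡ r + u
    lemma = solve-∀

  residues : Bijection → Permutation n n
  residues h = permutation (λ i → class (to h (rep i))) (λ i → class (from h (rep i)))
    (λ i → inverse h i) (λ i → inverse (h ⁻¹ᵇ) i)
    where
    inverse : ∀ h i → class (to h (rep (class (from h (rep i))))) ≡ i
    inverse h i = trans (cong class eq) (class-rep i t)
      where
      t = - D (from h (rep i) - + 1)
      eq : to h (rep (class (from h (rep i)))) ≡ rep i + t * N
      eq = trans (cong (to h) (rep-class (from h (rep i))))
        (trans (equivariant-multiple (to h) (to-+N h) (from h (rep i)) t) (cong (_+ t * N) (to-from h (rep i))))

  module ResidueSum (M : CommutativeMonoid 0ℓ 0ℓ) where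
    open CommutativeMonoid M using (Carrier; _≈_; _∙_; reflexive) renaming (sym to ≈-sym; trans to ≈-trans)
    open MonoidSum M using (sum; sum-permute; sum-cong-≗; ∑-distrib-+)

    opaque
      ∑ : (ℤ → Carrier) → Carrier
      ∑ g = sum {n} (g ∘ rep)

      ∑-unfold : ∀ g → ∑ g ≡ sum {n} (g ∘ rep)
      ∑-unfold g = refl

    ∑-cong : ∀ {f g} → (∀ x → f x ≡ g x) → ∑ f ≡ ∑ g
    ∑-cong {f} {g} eq = trans (∑-unfold f) (trans (sum-cong-≗ (eq ∘ rep)) (sym (∑-unfold g)))

    ∑-+ : ∀ f g → ∑ (λ x → f x ∙ g x) ≈ ∑ f ∙ ∑ g
    ∑-+ f g = ≈-trans (reflexive (∑-unfold (λ x → f x ∙ g x))) (≈-trans (∑-distrib-+ (f ∘ rep) (g ∘ rep))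
      (reflexive (sym (cong₂ _∙_ (∑-unfold f) (∑-unfold g)))))

    ∑-reindex : ∀ g → (∀ x → g (x + N) ≡ g x) → (h : Bijection) → ∑ (g ∘ to h) ≈ ∑ g
    ∑-reindex g per h = ≈-trans (reflexive (trans (∑-unfold (g ∘ to h)) (sum-cong-≗ pointwise)))
      (≈-trans (≈-sym (sum-permute (g ∘ rep) (residues h))) (reflexive (sym (∑-unfold g))))
      where
      -- Moving a value of `h` back to the representative of its class leaves the periodic `g`
      -- unchanged, and on classes `h` acts by the permutation `residues h`.
      pointwise : ∀ i → g (to h (rep i)) ≡ g (rep (class (to h (rep i))))
      pointwise i = trans (sym (periodic-multiple N g per (to h (rep i)) (- D (to h (rep i) - + 1))))
        (cong g (sym (rep-class (to h (rep i)))))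

  module ℕ∑ = ResidueSum ℕP.+-0-commutativeMonoid
  module ℤ∑ = ResidueSum ℤP.+-0-commutativeMonoid
  module ℕSum = SemiringSum ℕP.+-*-semiring
  module ℤSum = SemiringSum ℤP.+-*-semiring
  open ℕ∑ using (∑; ∑-cong; ∑-reindex; ∑-unfold; ∑-+)

  sum-mono-≤ : ∀ {m} {f g : Fin m → ℕ} → (∀ i → f i ℕ.≤ g i) → ℕSum.sum f ℕ.≤ ℕSum.sum g
  sum-mono-≤ {zero}  le = ℕ.z≤n
  sum-mono-≤ {suc m} le = ℕP.+-mono-≤ (le Fin.zero) (sum-mono-≤ (le ∘ Fin.suc))

  ∑-mono : ∀ {f g} → (∀ x → f x ℕ.≤ g x) → ∑ f ℕ.≤ ∑ g
  ∑-mono {f} {g} le = subst₂ ℕ._≤_ (sym (∑-unfold f)) (sym (∑-unfold g)) (sum-mono-≤ (le ∘ rep))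

  sum-const : ∀ m c → ℕSum.sum {m} (λ _ → c) ≡ m ℕ.* c
  sum-const zero    c = refl
  sum-const (suc m) c = cong (c ℕ.+_) (sum-const m c)

  ∑-const : ∀ c → ∑ (λ _ → c) ≡ n ℕ.* c
  ∑-const c = trans (∑-unfold (λ _ → c)) (sum-const n c)

  ∑-*ˡ : ∀ c f → ∑ (λ x → c ℕ.* f x) ≡ c ℕ.* ∑ f
  ∑-*ˡ c f = trans (∑-unfold (λ x → c ℕ.* f x)) (trans (sym (ℕSum.*-distribˡ-sum {n} c (f ∘ rep))) (cong (c ℕ.*_) (sym (∑-unfold f))))

  ∑∑ : (ℤ → ℤ → ℕ) → ℕ
  ∑∑ F = ∑ (λ x → ∑ (F x))

  ∑∑-cong : ∀ {F G} → (∀ x y → F x y ≡ G x y) → ∑∑ F ≡ ∑∑ G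
  ∑∑-cong eq = ∑-cong (λ x → ∑-cong (eq x))

  ∑∑-mono : ∀ {F G} → (∀ x y → F x y ℕ.≤ G x y) → ∑∑ F ℕ.≤ ∑∑ G
  ∑∑-mono le = ∑-mono (λ x → ∑-mono (le x))

  ∑∑-+ : ∀ F G → ∑∑ (λ x y → F x y ℕ.+ G x y) ≡ ∑∑ F ℕ.+ ∑∑ G
  ∑∑-+ F G = trans (∑-cong (λ x → ∑-+ (F x) (G x))) (∑-+ (λ x → ∑ (F x)) (λ x → ∑ (G x)))

  Biperiodic : (ℤ → ℤ → ℕ) → Set
  Biperiodic F = (∀ x y → F (x + N) y ≡ F x y) × (∀ x y → F x (y + N) ≡ F x y)

  ∑∑-reindex : ∀ {F} → Biperiodic F → (g h : Bijection) →
    ∑∑ (λ x y → F (to g x) (to h y)) ≡ ∑∑ F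
  ∑∑-reindex {F} (perˡ , perʳ) g h = trans
    (∑-cong (λ x → ∑-reindex (F (to g x)) (perʳ (to g x)) h))
    (∑-reindex (λ x → ∑ (F x)) (λ x → ∑-cong (perˡ x)) g)

  -- Twice the gallery distance between the alcoves of f and g: the number of
  -- reflecting hyperplanes separating them, counted once per ordered pair of residues.
  gap : (f g : ℤ → ℤ) → ℤ → ℤ → ℕ
  gap f g x y = ∣ D (f y - f x) - D (g y - g x) ∣

  dist : (f g : ℤ → ℤ) → ℕ
  dist f g = ∑∑ (gap f g)

  D-difference-+Nʳ : ∀ f → Equivariant f → ∀ x y → D (f (y + N) - f x) ≡ D (f y - f x) + + 1
  D-difference-+Nʳ f eqv x y = trans (cong (λ z → D (z - f x)) (eqv y))
    (trans (cong D (lemma (f y) (f x) N)) (D-shift (f y - f x) (+ 1)))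
    where
    lemma : ∀ a b m → a + m - b ≡ a - b + + 1 * m
    lemma = solve-∀

  D-difference-+Nˡ : ∀ f → Equivariant f → ∀ x y → D (f y - f (x + N)) ≡ D (f y - f x) - + 1
  D-difference-+Nˡ f eqv x y = trans (cong (λ z → D (f y - z)) (eqv x))
    (trans (cong D (lemma (f y) (f x) N)) (D-shift (f y - f x) -[1+ 0 ]))
    where
    lemma : ∀ a b m → a - (b + m) ≡ a - b + -[1+ 0 ] * m
    lemma = solve-∀

  -- Neither floor is periodic, but a shift of an argument by n changes both by the same unit, so
  -- their difference depends on residues only.
  gap-biperiodic : ∀ f g → Equivariant f → Equivariant g → Biperiodic (gap f g)
  gap-biperiodic f g F G =
    (λ x y → cong ∣_∣ (trans (cong₂ _-_ (D-difference-+Nˡ f F x y) (D-difference-+Nˡ g G x y))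
      (lemma₁ (D (f y - f x)) (D (g y - g x))))) ,
    (λ x y → cong ∣_∣ (trans (cong₂ _-_ (D-difference-+Nʳ f F x y) (D-difference-+Nʳ g G x y))
      (lemma₂ (D (f y - f x)) (D (g y - g x)))))
    where
    lemma₁ : ∀ a b → a - + 1 - (b - + 1) ≡ a - b
    lemma₁ = solve-∀
    lemma₂ : ∀ a b → a + + 1 - (b + + 1) ≡ a - b
    lemma₂ = solve-∀

  gap-sym : ∀ f g x y → gap f g x y ≡ gap g f x y
  gap-sym f g x y = ℤP.∣i-j∣≡∣j-i∣ (D (f y - f x)) (D (g y - g x))

  dist-sym : ∀ f g → dist f g ≡ dist g f
  dist-sym f g = ∑∑-cong (gap-sym f g)

  dist-triangle : ∀ f g h → dist f h ℕ.≤ dist f g ℕ.+ dist g h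
  dist-triangle f g h = ℕP.≤-trans (∑∑-mono triangle) (ℕP.≤-reflexive (∑∑-+ (gap f g) (gap g h)))
    where
    triangle : ∀ x y → gap f h x y ℕ.≤ gap f g x y ℕ.+ gap g h x y
    triangle x y = subst (λ z → ∣ z ∣ ℕ.≤ gap f g x y ℕ.+ gap g h x y)
      (ℤP.+-minus-telescope (D (f y - f x)) (D (g y - g x)) (D (h y - h x)))
      (ℤP.∣i+j∣≤∣i∣+∣j∣ (D (f y - f x) - D (g y - g x)) (D (g y - g x) - D (h y - h x)))

  dist-reindex : ∀ f g → Equivariant f → Equivariant g → (h : Bijection) →
    dist (f ∘ to h) (g ∘ to h) ≡ dist f g
  dist-reindex f g F G h = ∑∑-reindex (gap-biperiodic f g F G) h h

  dist-cong : ∀ {f f′ g g′ : ℤ → ℤ} → (∀ x → f x ≡ f′ x) → (∀ x → g x ≡ g′ x) → dist f g ≡ dist f′ g′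
  dist-cong F G = ∑∑-cong λ x y → cong ∣_∣
    (cong₂ (λ a b → D a - D b) (cong₂ _-_ (F y) (F x)) (cong₂ _-_ (G y) (G x)))

  ‖_‖ : Bijection → ℕ
  ‖ f ‖ = dist (to f) id

  ‖⁻¹‖ : ∀ f → ‖ f ⁻¹ᵇ ‖ ≡ ‖ f ‖
  ‖⁻¹‖ f = begin
    dist (from f) id               ≡⟨ dist-reindex (from f) id (from-+N f) (λ _ → refl) f ⟨
    dist (from f ∘ to f) (to f)    ≡⟨ dist-cong {g = to f} (from-to f) (λ _ → refl) ⟩
    dist id (to f)                 ≡⟨ dist-sym id (to f) ⟩
    dist (to f) id                 ∎
    where open ≡-Reasoning

  ‖∘‖ : ∀ f g → ‖ f ∘ᵇ g ‖ ℕ.≤ ‖ f ‖ ℕ.+ ‖ g ‖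
  ‖∘‖ f g = begin
    dist (to f ∘ to g) id                                   ≤⟨ dist-triangle (to f ∘ to g) (to g) id ⟩
    dist (to f ∘ to g) (to g) ℕ.+ dist (to g) id            ≡⟨ cong (ℕ._+ dist (to g) id) (dist-reindex (to f) id (to-+N f) (λ _ → refl) g) ⟩
    dist (to f) id ℕ.+ dist (to g) id                       ∎
    where open ℕP.≤-Reasoning

  ‖‖-cong : ∀ {f g} → (∀ x → to f x ≡ to g x) → ‖ f ‖ ≡ ‖ g ‖
  ‖‖-cong eq = dist-cong {g = id} eq (λ _ → refl)

  ‖id‖ : ‖ idᵇ ‖ ≡ 0
  ‖id‖ = trans (∑∑-cong λ x y → cong ∣_∣ (ℤP.+-inverseʳ (D (y - x))))
    (trans (∑-cong (λ _ → trans (∑-const 0) (ℕP.*-zeroʳ n))) (trans (∑-const 0) (ℕP.*-zeroʳ n)))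

  -- Drift: the total displacement over one period

  -- By `drift-∘` a homomorphism from periodic bijections to the integers; by `drift-sumTo` its
  -- kernel is the affine symmetric group.
  drift : (ℤ → ℤ) → ℤ
  drift f = ℤ∑.∑ (λ x → f x - x)

  difference-periodic : ∀ f → Equivariant f → ∀ x → f (x + N) - (x + N) ≡ f x - x
  difference-periodic f F x = trans (cong (_- (x + N)) (F x)) (lemma (f x) x N)
    where
    lemma : ∀ a y m → a + m - (y + m) ≡ a - y
    lemma = solve-∀

  drift-∘ : ∀ f → Equivariant f → (h : Bijection) → drift (f ∘ to h) ≡ drift f + drift (to h)
  drift-∘ f F h = begin
    ℤ∑.∑ (λ x → f (g x) - x)                                ≡⟨ ℤ∑.∑-cong (λ x → sym (ℤP.+-minus-telescope (f (g x)) (g x) x)) ⟩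
    ℤ∑.∑ (λ x → (f (g x) - g x) + (g x - x))                ≡⟨ ℤ∑.∑-+ (λ x → f (g x) - g x) (λ x → g x - x) ⟩
    ℤ∑.∑ (λ x → f (g x) - g x) + drift g                    ≡⟨ cong (_+ drift g) (ℤ∑.∑-reindex (λ x → f x - x) (difference-periodic f F) h) ⟩
    drift f + drift g                                       ∎
    where
    open ≡-Reasoning
    g = to h

  zsum-const : ∀ m c → ℤSum.sum {m} (λ _ → c) ≡ + m * c
  zsum-const zero    c = refl
  zsum-const (suc m) c = trans (cong (λ s → c + s) (zsum-const m c)) (lemma (+ m) c)
    where
    lemma : ∀ m c → c + m * c ≡ (+ 1 + m) * c
    lemma = solve-∀

  drift-+ : ∀ f c → drift (λ x → f x + c) ≡ drift f + N * c
  drift-+ f c = begin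
    ℤ∑.∑ (λ x → f x + c - x)            ≡⟨ ℤ∑.∑-cong (λ x → lemma (f x) x c) ⟩
    ℤ∑.∑ (λ x → (f x - x) + c)          ≡⟨ ℤ∑.∑-+ (λ x → f x - x) (λ _ → c) ⟩
    drift f + ℤ∑.∑ (λ _ → c)            ≡⟨ cong (λ s → drift f + s) (trans (ℤ∑.∑-unfold (λ _ → c)) (zsum-const n c)) ⟩
    drift f + N * c                     ∎
    where
    open ≡-Reasoning
    lemma : ∀ a x c → a + c - x ≡ (a - x) + c
    lemma = solve-∀

  Multiple-0 : ∀ {x} → x ≡ + 0 → Multiple x
  Multiple-0 eq = + 0 , eq

  ¬Multiple-1 : ¬ Multiple (+ 1)
  ¬Multiple-1 = small-not-multiple (ℤ.+<+ (ℕ.s≤s ℕ.z≤n)) (ℤ.+<+ (ℕ.s≤s (ℕ.s≤s ℕ.z≤n)))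

  Multiple-by : ∀ {x y} → Multiple x → y ≡ x → Multiple y
  Multiple-by (t , eq) eq′ = t , trans eq′ eq

  -- The generators

  data Position (k j : ℤ) : Set where
    at    : Multiple (j - k) → Position k j
    next  : Multiple (j - (k + + 1)) → Position k j
    other : ¬ Multiple (j - k) → ¬ Multiple (j - (k + + 1)) → Position k j

  position : ∀ k j → Position k j
  position k j with multiple? (j - k) | multiple? (j - (k + + 1))
  ... | yes m | _     = at m
  ... | no  _ | yes m = next m
  ... | no  a | no  b = other a b

  at⇒¬next : ∀ k j → Multiple (j - k) → ¬ Multiple (j - (k + + 1))
  at⇒¬next k j m m′ = ¬Multiple-1 (Multiple-by (Multiple-difference m m′) (lemma j k))
    where
    lemma : ∀ j k → + 1 ≡ j - k - (j - (k + + 1))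
    lemma = solve-∀

  gen-at : ∀ i j → Multiple (j - + i) → genℕ n i j ≡ j + + 1
  gen-at i j (t , eq) rewrite %-unique {j - + i} {0} t (ℕ.s≤s ℕ.z≤n) (trans eq (sym (ℤP.+-identityˡ (t * N)))) = refl

  gen-next : ∀ i j → Multiple (j - (+ i + + 1)) → genℕ n i j ≡ j - + 1
  gen-next i j (t , eq) = evaluate (%-unique {j - + i} {1} t (ℕ.s≤s (ℕ.s≤s ℕ.z≤n)) (trans (lemma j (+ i)) (cong (λ s → + 1 + s) eq)))
    where
    lemma : ∀ j k → j - k ≡ + 1 + (j - (k + + 1))
    lemma = solve-∀
    evaluate : (j - + i) %ℕ n ≡ 1 → genℕ n i j ≡ j - + 1
    evaluate eq rewrite eq = refl

  gen-other : ∀ i j → ¬ Multiple (j - + i) → ¬ Multiple (j - (+ i + + 1)) → genℕ n i j ≡ j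
  gen-other i j ¬m ¬m′ with (j - + i) %ℕ n in eq
  ... | 0 = contradiction (D (j - + i) , trans (%-decomposition (j - + i))
              (trans (cong (λ r → + r + D (j - + i) * N) eq) (ℤP.+-identityˡ (D (j - + i) * N)))) ¬m
  ... | 1 = contradiction (D (j - + i) , trans (lemma j (+ i)) (trans (cong (_- + 1)
              (trans (%-decomposition (j - + i)) (cong (λ r → + r + D (j - + i) * N) eq))) (lemma′ (D (j - + i) * N)))) ¬m′
    where
    lemma : ∀ j k → j - (k + + 1) ≡ j - k - + 1
    lemma = solve-∀
    lemma′ : ∀ u → + 1 + u - + 1 ≡ u
    lemma′ = solve-∀
  ... | suc (suc r) = refl

  next-of-at : ∀ k j → Multiple (j - k) → Multiple (j + + 1 - (k + + 1))
  next-of-at k j m = Multiple-by m (lemma j k)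
    where
    lemma : ∀ j k → j + + 1 - (k + + 1) ≡ j - k
    lemma = solve-∀

  at-of-next : ∀ k j → Multiple (j - (k + + 1)) → Multiple (j - + 1 - k)
  at-of-next k j m = Multiple-by m (lemma j k)
    where
    lemma : ∀ j k → j - + 1 - k ≡ j - (k + + 1)
    lemma = solve-∀

  gen-involutive : ∀ i j → genℕ n i (genℕ n i j) ≡ j
  gen-involutive i j with position (+ i) j
  ... | at m      = trans (cong (genℕ n i) (gen-at i j m)) (trans (gen-next i (j + + 1) (next-of-at (+ i) j m)) (lemma j))
    where
    lemma : ∀ j → j + + 1 - + 1 ≡ j
    lemma = solve-∀
  ... | next m    = trans (cong (genℕ n i) (gen-next i j m)) (trans (gen-at i (j - + 1) (at-of-next (+ i) j m)) (lemma j))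
    where
    lemma : ∀ j → j - + 1 + + 1 ≡ j
    lemma = solve-∀
  ... | other a b = trans (cong (genℕ n i) (gen-other i j a b)) (gen-other i j a b)

  Multiple-N : Multiple N
  Multiple-N = + 1 , sym (ℤP.*-identityˡ N)

  Multiple-+N : ∀ c j → Multiple (j - c) → Multiple (j + N - c)
  Multiple-+N c j m = Multiple-by (Multiple-sum m Multiple-N) (lemma j c N)
    where
    lemma : ∀ j c m → j + m - c ≡ j - c + m
    lemma = solve-∀

  Multiple-cancel-+N : ∀ c j → Multiple (j + N - c) → Multiple (j - c)
  Multiple-cancel-+N c j m = Multiple-by (Multiple-difference m Multiple-N) (lemma j c N)
    where
    lemma : ∀ j c m → j - c ≡ j + m - c - m
    lemma = solve-∀

  gen-+N : ∀ i → Equivariant (genℕ n i)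
  gen-+N i j with position (+ i) j
  ... | at m      = trans (gen-at i (j + N) (Multiple-+N (+ i) j m)) (trans (lemma j N) (cong (_+ N) (sym (gen-at i j m))))
    where
    lemma : ∀ j m → j + m + + 1 ≡ j + + 1 + m
    lemma = solve-∀
  ... | next m    = trans (gen-next i (j + N) (Multiple-+N (+ i + + 1) j m)) (trans (lemma j N) (cong (_+ N) (sym (gen-next i j m))))
    where
    lemma : ∀ j m → j + m - + 1 ≡ j - + 1 + m
    lemma = solve-∀
  ... | other a b = trans (gen-other i (j + N) (a ∘ Multiple-cancel-+N (+ i) j) (b ∘ Multiple-cancel-+N (+ i + + 1) j)) (cong
      (_+ N) (sym (gen-other i j a b)))

  gen : ℕ → Bijection
  gen i = record
    { to = genℕ n i ; from = genℕ n i
    ; from-to = gen-involutive i ; to-from = gen-involutive i ; to-+N = gen-+N i }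

  χ-cong : ∀ {x y} → Multiple (x - y) → χ x ≡ χ y
  χ-cong {x} {y} m with multiple? y
  ... | yes m′ = trans (χ-yes (Multiple-by (Multiple-sum m m′) (lemma x y))) (sym (χ-yes m′))
    where
    lemma : ∀ x y → x ≡ x - y + y
    lemma = solve-∀
  ... | no ¬m′ = trans (χ-no (λ m″ → ¬m′ (Multiple-by (Multiple-difference m″ m) (lemma x y)))) (sym (χ-no ¬m′))
    where
    lemma : ∀ x y → y ≡ x - (x - y)
    lemma = solve-∀

  χ-+N : ∀ c x → χ (x + N - c) ≡ χ (x - c)
  χ-+N c x = χ-cong (Multiple-by Multiple-N (lemma x c N))
    where
    lemma : ∀ x c m → x + m - c - (x - c) ≡ m
    lemma = solve-∀

  ∑χ : ∀ c → ∑ (λ x → χ (x - c)) ≡ 1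
  ∑χ c = begin
    ∑ (λ x → χ (x - c))                          ≡⟨ ∑-cong (λ x → cong χ (lemma x c)) ⟩
    ∑ (λ x → χ (x - + 1 - (c - + 1)))            ≡⟨ ∑-cong (λ x → cong χ (lemma′ x c)) ⟩
    -- After translating `c` to 1 the first representative is the only one counted; the others
    -- differ from 1 by at least 1 and at most n - 1.
    ∑ (λ x → χ (x + (+ 1 - c) - + 1))            ≡⟨ ∑-reindex (λ x → χ (x - + 1)) (χ-+N (+ 1)) (translate (+ 1 - c)) ⟩
    ∑ (λ x → χ (x - + 1))                        ≡⟨ ∑-unfold (λ x → χ (x - + 1)) ⟩
    χ (+ 0) ℕ.+ ℕSum.sum {suc p} (λ i → χ (+ suc (toℕ i))) ≡⟨ cong₂ ℕ._+_ (χ-yes (Multiple-0 refl)) (trans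
        (ℕSum.sum-cong-≗ {suc p} (λ i → χ-no (small i))) (trans (sum-const (suc p) 0) (ℕP.*-zeroʳ (suc p)))) ⟩
    1                                            ∎
    where
    open ≡-Reasoning
    lemma : ∀ x c → x - c ≡ x - + 1 - (c - + 1)
    lemma = solve-∀
    lemma′ : ∀ x c → x - + 1 - (c - + 1) ≡ x + (+ 1 - c) - + 1
    lemma′ = solve-∀
    small : ∀ (i : Fin (suc p)) → ¬ Multiple (+ suc (toℕ i))
    small i = small-not-multiple (ℤ.+<+ (ℕ.s≤s ℕ.z≤n)) (ℤ.+<+ (ℕ.s≤s (FinP.toℕ<n i)))

  D-suc : ∀ a → ¬ Multiple (a + + 1) → D (a + + 1) ≡ D a
  D-suc a ¬m with residue a
  ... | r , r<n , eq with suc r ℕ.≟ n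
  ... | yes refl = contradiction (D a + + 1 , trans (cong (_+ + 1) eq) (lemma (+ r) (D a))) ¬m
    where
    lemma : ∀ r d → r + d * (+ 1 + r) + + 1 ≡ (d + + 1) * (+ 1 + r)
    lemma = solve-∀
  ... | no r≢ = trans (cong D (trans (cong (_+ + 1) eq) (lemma (+ r) (D a * N)))) (D-remainder (D a) (ℕP.≤∧≢⇒< r<n r≢))
    where
    lemma : ∀ r u → r + u + + 1 ≡ (+ 1 + r) + u
    lemma = solve-∀

  D-pred : ∀ a → ¬ Multiple a → D (a - + 1) ≡ D a
  D-pred a ¬m = trans (sym (D-suc (a - + 1) (¬m ∘ λ m → Multiple-by m (sym (lemma a))))) (cong D (lemma a))
    where
    lemma : ∀ a → a - + 1 + + 1 ≡ a
    lemma = solve-∀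

  D-+1 : ∀ t → D (+ 1 + t * N) ≡ t
  D-+1 t = D-remainder t (ℕ.s≤s (ℕ.s≤s ℕ.z≤n))

  D-below-multiple : ∀ t → D (t * N - + 1) ≡ t - + 1
  D-below-multiple t = trans (cong D (lemma t N)) (D-remainder (t - + 1) (ℕP.n<1+n (suc p)))
    where
    lemma : ∀ t m → t * m - + 1 ≡ m - + 1 + (t - + 1) * m
    lemma = solve-∀

  module Generator (i : ℕ) where
    k = + i
    s = genℕ n i

    rising falling : ℤ → ℤ → ℕ
    rising  x y = χ (x - k) ℕ.* χ (y - (k + + 1))
    falling x y = χ (x - (k + + 1)) ℕ.* χ (y - k)

    -- The swap affects the floor of a difference only between the classes of `k` and `k + 1`: there
    -- the difference lies one above or one below a multiple of n and passes to the other side of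
    -- it. This pair of classes occurs once in each order, hence the 2 in the norm of a generator.
    data Pair (x y : ℤ) : Set where
      neutral : D (s y - s x) ≡ D (y - x) → rising x y ≡ 0 → falling x y ≡ 0 → Pair x y
      rises   : ∀ a b → x ≡ k + a * N → y ≡ k + + 1 + b * N →
                D (y - x) ≡ b - a → D (s y - s x) ≡ b - a - + 1 → rising x y ≡ 1 → falling x y ≡ 0 → Pair x y
      falls   : ∀ a b → x ≡ k + + 1 + a * N → y ≡ k + b * N →
                D (y - x) ≡ b - a - + 1 → D (s y - s x) ≡ b - a → rising x y ≡ 0 → falling x y ≡ 1 → Pair x y

    ℕ*-zero : ∀ {a b} → a ≡ 0 ⊎ b ≡ 0 → a ℕ.* b ≡ 0
    ℕ*-zero         (inj₁ refl) = refl
    ℕ*-zero {a}     (inj₂ refl) = ℕP.*-zeroʳ a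

    move : ∀ c x {t} → x - c ≡ t → x ≡ c + t
    move c x eq = trans (lemma x c) (cong (λ u → c + u) eq)
      where
      lemma : ∀ x c → x ≡ c + (x - c)
      lemma = solve-∀

    pair : ∀ x y → Pair x y
    pair x y with position k x | position k y
    ... | at m | at m′ = neutral
      (cong D (trans (cong₂ _-_ (gen-at i y m′) (gen-at i x m)) (lemma y x)))
      (ℕ*-zero {χ (x - k)} (inj₂ (χ-no (at⇒¬next k y m′)))) (ℕ*-zero (inj₁ (χ-no (at⇒¬next k x m))))
      where
      lemma : ∀ y x → y + + 1 - (x + + 1) ≡ y - x
      lemma = solve-∀
    ... | next m | next m′ = neutral
      (cong D (trans (cong₂ _-_ (gen-next i y m′) (gen-next i x m)) (lemma y x)))
      (ℕ*-zero (inj₁ (χ-no (λ z → at⇒¬next k x z m)))) (ℕ*-zero {χ (x - (k + + 1))} (inj₂ (χ-no (λ z → at⇒¬next k y z m′))))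
      where
      lemma : ∀ y x → y - + 1 - (x - + 1) ≡ y - x
      lemma = solve-∀
    ... | other a b | other c d = neutral
      (cong D (cong₂ _-_ (gen-other i y c d) (gen-other i x a b)))
      (ℕ*-zero (inj₁ (χ-no a))) (ℕ*-zero (inj₁ (χ-no b)))
    ... | at m@(a , eq) | next m′@(b , eq′) = rises a b (move k x eq) (move (k + + 1) y eq′)
      (trans (cong D (trans (cong₂ _-_ (move (k + + 1) y eq′) (move k x eq)) (lemma k a b N))) (D-+1 (b - a)))
      (trans (cong D (trans (cong₂ _-_ (gen-next i y m′) (gen-at i x m)) (trans (cong₂ (λ u v → u - + 1 - (v + + 1)) (move
          (k + + 1) y eq′) (move k x eq)) (lemma′ k a b N)))) (D-below-multiple (b - a)))
      (cong₂ ℕ._*_ (χ-yes m) (χ-yes m′)) (ℕ*-zero (inj₁ (χ-no (at⇒¬next k x m))))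
      where
      lemma : ∀ k a b m → k + + 1 + b * m - (k + a * m) ≡ + 1 + (b - a) * m
      lemma = solve-∀
      lemma′ : ∀ k a b m → k + + 1 + b * m - + 1 - (k + a * m + + 1) ≡ (b - a) * m - + 1
      lemma′ = solve-∀
    ... | next m@(a , eq) | at m′@(b , eq′) = falls a b (move (k + + 1) x eq) (move k y eq′)
      (trans (cong D (trans (cong₂ _-_ (move k y eq′) (move (k + + 1) x eq)) (lemma k a b N))) (D-below-multiple (b - a)))
      (trans (cong D (trans (cong₂ _-_ (gen-at i y m′) (gen-next i x m)) (trans (cong₂ (λ u v → u + + 1 - (v - + 1))
          (move k y eq′) (move (k + + 1) x eq)) (lemma′ k a b N)))) (D-+1 (b - a)))
      (ℕ*-zero (inj₁ (χ-no (λ z → at⇒¬next k x z m)))) (cong₂ ℕ._*_ (χ-yes m) (χ-yes m′))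
      where
      lemma : ∀ k a b m → k + b * m - (k + + 1 + a * m) ≡ (b - a) * m - + 1
      lemma = solve-∀
      lemma′ : ∀ k a b m → k + b * m + + 1 - (k + + 1 + a * m - + 1) ≡ + 1 + (b - a) * m
      lemma′ = solve-∀
    -- In the four mixed cases one entry moves by one. The floor could change only if the difference
    -- met a multiple of n, which would put the stationary entry in the class of `k` or `k + 1`,
    -- against `other`.
    ... | other a b | at m = neutral
      (trans (cong D (trans (cong₂ _-_ (gen-at i y m) (gen-other i x a b)) (lemma y x))) (D-suc (y - x) (λ z → b (Multiple-by
          (Multiple-difference m z) (lemma′ y x k)))))
      (ℕ*-zero (inj₁ (χ-no a))) (ℕ*-zero (inj₁ (χ-no b)))
      where
      lemma : ∀ y x → y + + 1 - x ≡ y - x + + 1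
      lemma = solve-∀
      lemma′ : ∀ y x k → x - (k + + 1) ≡ y - k - (y - x + + 1)
      lemma′ = solve-∀
    ... | other a b | next m = neutral
      (trans (cong D (trans (cong₂ _-_ (gen-next i y m) (gen-other i x a b)) (lemma y x))) (D-pred (y - x) (λ z → b
          (Multiple-by (Multiple-difference m z) (lemma′ y x k)))))
      (ℕ*-zero (inj₁ (χ-no a))) (ℕ*-zero (inj₁ (χ-no b)))
      where
      lemma : ∀ y x → y - + 1 - x ≡ y - x - + 1
      lemma = solve-∀
      lemma′ : ∀ y x k → x - (k + + 1) ≡ y - (k + + 1) - (y - x)
      lemma′ = solve-∀
    ... | at m | other a b = neutral
      (trans (cong D (trans (cong₂ _-_ (gen-other i y a b) (gen-at i x m)) (lemma y x))) (D-pred (y - x) (λ z → a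
          (Multiple-by (Multiple-sum m z) (lemma′ y x k)))))
      (ℕ*-zero {χ (x - k)} (inj₂ (χ-no b))) (ℕ*-zero {χ (x - (k + + 1))} (inj₂ (χ-no a)))
      where
      lemma : ∀ y x → y - (x + + 1) ≡ y - x - + 1
      lemma = solve-∀
      lemma′ : ∀ y x k → y - k ≡ x - k + (y - x)
      lemma′ = solve-∀
    ... | next m | other a b = neutral
      (trans (cong D (trans (cong₂ _-_ (gen-other i y a b) (gen-next i x m)) (lemma y x))) (D-suc (y - x) (λ z → a
          (Multiple-by (Multiple-sum m z) (lemma′ y x k)))))
      (ℕ*-zero {χ (x - k)} (inj₂ (χ-no b))) (ℕ*-zero {χ (x - (k + + 1))} (inj₂ (χ-no a)))
      where
      lemma : ∀ y x → y - (x - + 1) ≡ y - x + + 1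
      lemma = solve-∀
      lemma′ : ∀ y x k → y - k ≡ x - (k + + 1) + (y - x + + 1)
      lemma′ = solve-∀

    ∑∑-product : ∀ a b → ∑∑ (λ x y → χ (x - a) ℕ.* χ (y - b)) ≡ 1
    ∑∑-product a b = begin
      ∑ (λ x → ∑ (λ y → χ (x - a) ℕ.* χ (y - b)))  ≡⟨ ∑-cong (λ x → trans (∑-*ˡ (χ (x - a)) (λ y → χ (y - b))) (trans (cong
          (χ (x - a) ℕ.*_) (∑χ b)) (ℕP.*-identityʳ (χ (x - a))))) ⟩
      ∑ (λ x → χ (x - a))                          ≡⟨ ∑χ a ⟩
      1                                            ∎
      where open ≡-Reasoning

    ∑∑-rising+falling : ∑∑ (λ x y → rising x y ℕ.+ falling x y) ≡ 2
    ∑∑-rising+falling = trans (∑∑-+ rising falling)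
      (cong₂ ℕ._+_ (∑∑-product k (k + + 1)) (∑∑-product (k + + 1) k))

    ‖gen‖ : ‖ gen i ‖ ℕ.≤ 2
    ‖gen‖ = ℕP.≤-trans (∑∑-mono pointwise) (ℕP.≤-reflexive ∑∑-rising+falling)
      where
      pointwise : ∀ x y → gap s id x y ℕ.≤ rising x y ℕ.+ falling x y
      pointwise x y with pair x y
      ... | neutral eq r f = subst (ℕ._≤ rising x y ℕ.+ falling x y) (sym (cong ∣_∣ (ℤP.i≡j⇒i-j≡0 eq))) ℕ.z≤n
      ... | rises a b _ _ eq eq′ r f = ℕP.≤-reflexive (trans (cong ∣_∣ (trans (cong₂ _-_ eq′ eq) (lemma a b))) (sym (cong₂ ℕ._+_ r f)))
        where
        lemma : ∀ a b → b - a - + 1 - (b - a) ≡ -[1+ 0 ]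
        lemma = solve-∀
      ... | falls a b _ _ eq eq′ r f = ℕP.≤-reflexive (trans (cong ∣_∣ (trans (cong₂ _-_ eq′ eq) (lemma a b))) (sym (cong₂ ℕ._+_ r f)))
        where
        lemma : ∀ a b → b - a - (b - a - + 1) ≡ + 1
        lemma = solve-∀

    abs-below : ∀ q g → g ≤ q - + 1 → ∣ q - + 1 - g ∣ ℕ.+ 1 ≡ ∣ q - g ∣
    abs-below q g le = ℤP.+-injective (begin
      + ∣ q - + 1 - g ∣ + + 1     ≡⟨ cong (_+ + 1) (ℤP.0≤i⇒+∣i∣≡i (ℤP.i≤j⇒0≤j-i le)) ⟩
      q - + 1 - g + + 1           ≡⟨ lemma q g ⟩
      q - g                       ≡⟨ ℤP.0≤i⇒+∣i∣≡i (ℤP.i≤j⇒0≤j-i (ℤP.≤-trans le (≤-by-difference {+ 0} {+ 1} {q - + 1} {q}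
          (ℤ.+≤+ ℕ.z≤n) (lemma′ q)))) ⟨
      + ∣ q - g ∣                 ∎)
      where
      open ≡-Reasoning
      lemma : ∀ q g → q - + 1 - g + + 1 ≡ q - g
      lemma = solve-∀
      lemma′ : ∀ q → q - (q - + 1) ≡ + 1 - + 0
      lemma′ = solve-∀

    abs-above : ∀ q g → q ≤ g → ∣ q - g ∣ ℕ.+ 1 ≡ ∣ q - + 1 - g ∣
    abs-above q g le = trans (cong (ℕ._+ 1) (flip q g)) (trans (lemma q g le) (sym (flip (q - + 1) g)))
      where
      flip : ∀ a b → ∣ a - b ∣ ≡ ∣ b - a ∣
      flip = ℤP.∣i-j∣≡∣j-i∣
      lemma : ∀ q g → q ≤ g → ∣ g - q ∣ ℕ.+ 1 ≡ ∣ g - (q - + 1) ∣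
      lemma q g le = trans (cong (λ u → ∣ u ∣ ℕ.+ 1) (l₁ q g)) (trans (abs-below (g + + 1) q (≤-by-difference le (l₂ q g))) (cong ∣_∣ (l₃ q g)))
        where
        l₁ : ∀ q g → g - q ≡ g + + 1 - + 1 - q
        l₁ = solve-∀
        l₂ : ∀ q g → g + + 1 - + 1 - q ≡ g - q
        l₂ = solve-∀
        l₃ : ∀ q g → g + + 1 - q ≡ g - (q - + 1)
        l₃ = solve-∀

    -- The hypothesis puts `g` on the same side as `s` of the hyperplane between `s` and the
    -- identity: on rising pairs the floor for `g` is at most `b - a - 1`, on falling pairs at least
    -- `b - a`. So `s` is closer than the identity by one in each order.
    descent : ∀ g → Equivariant g → g (k + + 1) < g k → dist s g ℕ.+ 2 ℕ.≤ dist id g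
    descent g G lt = begin
      dist s g ℕ.+ 2                                                    ≡⟨ cong (dist s g ℕ.+_) ∑∑-rising+falling ⟨
      dist s g ℕ.+ ∑∑ (λ x y → rising x y ℕ.+ falling x y)              ≡⟨ ∑∑-+ (gap s g) (λ x y → rising x y ℕ.+ falling x y) ⟨
      ∑∑ (λ x y → gap s g x y ℕ.+ (rising x y ℕ.+ falling x y))         ≤⟨ ∑∑-mono pointwise ⟩
      dist id g                                                         ∎
      where
      open ℕP.≤-Reasoning
      difference : ∀ {x y c d} a b → x ≡ c + a * N → y ≡ d + b * N → g y - g x ≡ g d - g c + (b - a) * N
      difference {c = c} {d} a b refl refl = trans
        (cong₂ _-_ (equivariant-multiple g G d b) (equivariant-multiple g G c a)) (lemma (g d) (g c) a b N)
        where
        lemma : ∀ u v a b m → u + b * m - (v + a * m) ≡ u - v + (b - a) * m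
        lemma = solve-∀
      pointwise : ∀ x y → gap s g x y ℕ.+ (rising x y ℕ.+ falling x y) ℕ.≤ gap id g x y
      pointwise x y with pair x y
      ... | neutral eq r f = ℕP.≤-reflexive (trans (cong₂ ℕ._+_ (cong (λ q → ∣ q - D (g y - g x) ∣) eq) (cong₂ ℕ._+_ r f))
          (ℕP.+-identityʳ (gap id g x y)))
      ... | rises a b eqx eqy eq eq′ r f = ℕP.≤-reflexive (trans
          (cong₂ ℕ._+_ (cong (λ q → ∣ q - D (g y - g x) ∣) eq′) (cong₂ ℕ._+_ r f))
          (trans (abs-below (b - a) (D (g y - g x)) below) (cong (λ q → ∣ q - D (g y - g x) ∣) (sym eq))))
        where
        lemma : ∀ u v q m → q * m - (u - v + q * m) ≡ v - u
        lemma = solve-∀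
        lemma′ : ∀ a b → b - a ≡ b - a - + 1 + + 1
        lemma′ = solve-∀
        below : D (g y - g x) ≤ b - a - + 1
        below = <1+⇒≤ (subst (D (g y - g x) <_) (lemma′ a b) (D< (subst (_< (b - a) * N) (sym (difference a b eqx eqy))
          (<-by-difference lt (lemma (g (k + + 1)) (g k) (b - a) N)))))
      ... | falls a b eqx eqy eq eq′ r f = ℕP.≤-reflexive (trans
          (cong₂ ℕ._+_ (cong (λ q → ∣ q - D (g y - g x) ∣) eq′) (cong₂ ℕ._+_ r f))
          (trans (abs-above (b - a) (D (g y - g x)) above) (cong (λ q → ∣ q - D (g y - g x) ∣) (sym eq))))
        where
        lemma : ∀ u v q m → v - u + q * m - q * m ≡ v - u
        lemma = solve-∀
        above : b - a ≤ D (g y - g x)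
        above = ≤D (subst ((b - a) * N ≤_) (sym (difference a b eqx eqy))
          (≤-by-difference (ℤP.<⇒≤ lt) (lemma (g (k + + 1)) (g k) (b - a) N)))

  -- Reduced words

  word : List ℕ → Bijection
  word []       = idᵇ
  word (i ∷ is) = gen i ∘ᵇ word is

  to-word : ∀ is x → to (word is) x ≡ prodℕ n is x
  to-word []       x = refl
  to-word (i ∷ is) x = cong (genℕ n i) (to-word is x)

  ‖word‖ : ∀ is → ‖ word is ‖ ℕ.≤ 2 ℕ.* length is
  ‖word‖ []       = ℕP.≤-reflexive ‖id‖
  ‖word‖ (i ∷ is) = ℕP.≤-trans (‖∘‖ (gen i) (word is)) (ℕP.≤-trans (ℕP.+-mono-≤ (Generator.‖gen‖ i) (‖word‖ is))
    (ℕP.≤-reflexive (sym (ℕP.*-suc 2 (length is)))))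

  drift-id : drift id ≡ + 0
  drift-id = trans (ℤ∑.∑-cong ℤP.+-inverseʳ) (trans (ℤ∑.∑-unfold (λ _ → + 0)) (trans (zsum-const n (+ 0)) (ℤP.*-zeroʳ N)))

  drift-cong : ∀ {f g : ℤ → ℤ} → (∀ x → f x ≡ g x) → drift f ≡ drift g
  drift-cong eq = ℤ∑.∑-cong (λ x → cong (_- x) (eq x))

  drift-from : ∀ f → drift (to f) + drift (from f) ≡ + 0
  drift-from f = trans (sym (drift-∘ (to f) (to-+N f) (f ⁻¹ᵇ))) (trans (drift-cong {g = id} (to-from f)) drift-id)

  ∑-pos : ∀ g → ℤ∑.∑ (λ x → + g x) ≡ + ∑ g
  ∑-pos g = trans (ℤ∑.∑-unfold (λ x → + g x)) (trans (go n (g ∘ rep)) (cong +_ (sym (∑-unfold g))))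
    where
    go : ∀ m (t : Fin m → ℕ) → ℤSum.sum (λ i → + t i) ≡ + ℕSum.sum t
    go zero    t = refl
    go (suc m) t = cong (λ s → + t Fin.zero + s) (go m (t ∘ Fin.suc))

  -- A generator moves one residue up and one residue down.
  drift-gen : ∀ i → drift (genℕ n i) ≡ + 0
  drift-gen i = ℤG.∙-cancelʳ (ℤ∑.∑ (λ x → + χ (x - (+ i + + 1)))) (drift (genℕ n i)) (+ 0) (begin
    drift (genℕ n i) + ℤ∑.∑ (λ x → + χ (x - (+ i + + 1)))             ≡⟨ ℤ∑.∑-+ (λ x → genℕ n i x - x) (λ x → + χ (x - (+ i + + 1))) ⟨
    ℤ∑.∑ (λ x → genℕ n i x - x + + χ (x - (+ i + + 1)))               ≡⟨ ℤ∑.∑-cong pointwise ⟩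
    ℤ∑.∑ (λ x → + χ (x - + i))                                        ≡⟨ total (+ i) ⟩
    + 1                                                               ≡⟨ total (+ i + + 1) ⟨
    ℤ∑.∑ (λ x → + χ (x - (+ i + + 1)))                                ≡⟨ ℤP.+-identityˡ _ ⟨
    + 0 + ℤ∑.∑ (λ x → + χ (x - (+ i + + 1)))                          ∎)
    where
    open ≡-Reasoning
    total : ∀ c → ℤ∑.∑ (λ x → + χ (x - c)) ≡ + 1
    total c = trans (∑-pos (λ x → χ (x - c))) (cong +_ (∑χ c))
    lemma₁ : ∀ x → x + + 1 - x + + 0 ≡ + 1
    lemma₁ = solve-∀
    lemma₂ : ∀ x → x - + 1 - x + + 1 ≡ + 0
    lemma₂ = solve-∀
    lemma₃ : ∀ x → x - x + + 0 ≡ + 0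
    lemma₃ = solve-∀
    pointwise : ∀ x → genℕ n i x - x + + χ (x - (+ i + + 1)) ≡ + χ (x - + i)
    pointwise x with position (+ i) x
    ... | at m      = trans (cong₂ (λ u c → u - x + + c) (gen-at i x m) (χ-no (at⇒¬next (+ i) x m))) (trans (lemma₁ x) (cong +_ (sym (χ-yes m))))
    ... | next m    = trans (cong₂ (λ u c → u - x + + c) (gen-next i x m) (χ-yes m)) (trans (lemma₂ x) (cong +_ (sym (χ-no
        (λ m′ → at⇒¬next (+ i) x m′ m)))))
    ... | other a b = trans (cong₂ (λ u c → u - x + + c) (gen-other i x a b) (χ-no b)) (trans (lemma₃ x) (cong +_ (sym (χ-no a))))

  -- Reindexing by the inverse of `f` turns the norm of the product into the distance from the
  -- generator to that inverse, where `descent` applies.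
  gen-descent : ∀ f (k : Fin n) → from f (rep k + + 1) < from f (rep k) →
    ‖ gen (suc (toℕ k)) ∘ᵇ f ‖ ℕ.+ 2 ℕ.≤ ‖ f ‖
  gen-descent f k lt = begin
    dist (s ∘ to f) id ℕ.+ 2                  ≡⟨ cong (ℕ._+ 2) (dist-reindex (s ∘ to f) id (to-+N (gen (suc (toℕ k)) ∘ᵇ f))
        (λ _ → refl) (f ⁻¹ᵇ)) ⟨
    dist (s ∘ to f ∘ from f) (from f) ℕ.+ 2   ≡⟨ cong (ℕ._+ 2) (dist-cong {g = from f} (λ x → cong s (to-from f x)) (λ _ → refl)) ⟩
    dist s (from f) ℕ.+ 2                     ≤⟨ Generator.descent (suc (toℕ k)) (from f) (from-+N f) lt ⟩
    dist id (from f)                          ≡⟨ dist-sym id (from f) ⟩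
    ‖ f ⁻¹ᵇ ‖                                 ≡⟨ ‖⁻¹‖ f ⟩
    ‖ f ‖                                     ∎
    where
    open ℕP.≤-Reasoning
    s = genℕ n (suc (toℕ k))

  -- The displacement `g x - x` is weakly increasing and n-periodic, hence constant.
  monotone-translation : ∀ g → Equivariant g → (∀ x → g x + + 1 ≤ g (x + + 1)) → ∀ x → g x ≡ x + g (+ 0)
  monotone-translation g G mono x = begin
    g x                   ≡⟨ lemma₁ (g x) x ⟩
    x + h x               ≡⟨ cong (λ y → x + h y) (lemma₂ x) ⟩
    x + h (+ 0 + x * + 1) ≡⟨ cong (λ u → x + u) (periodic-multiple (+ 1) h constant (+ 0) x) ⟩
    x + (g (+ 0) + + 0)   ≡⟨ cong (λ u → x + u) (ℤP.+-identityʳ (g (+ 0))) ⟩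
    x + g (+ 0)           ∎
    where
    open ≡-Reasoning
    h : ℤ → ℤ
    h x = g x - x
    lemma₁ : ∀ a x → a ≡ x + (a - x)
    lemma₁ = solve-∀
    lemma₂ : ∀ x → x ≡ + 0 + x * + 1
    lemma₂ = solve-∀
    h-step : ∀ x → h x ≤ h (x + + 1)
    h-step x = ≤-by-difference (mono x) (lemma (g x) (g (x + + 1)) x)
      where
      lemma : ∀ a b x → b - (x + + 1) - (a - x) ≡ b - (a + + 1)
      lemma = solve-∀
    h-mono : ∀ k x → h x ≤ h (x + + k)
    h-mono zero    x = ℤP.≤-reflexive (cong h (sym (ℤP.+-identityʳ x)))
    h-mono (suc k) x = ℤP.≤-trans (h-mono k x) (ℤP.≤-trans (h-step (x + + k)) (ℤP.≤-reflexive (cong h (lemma x (+ k)))))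
      where
      lemma : ∀ x k → x + k + + 1 ≡ x + (+ 1 + k)
      lemma = solve-∀
    constant : ∀ x → h (x + + 1) ≡ h x
    constant x = ℤP.≤-antisym
      (ℤP.≤-trans (h-mono (suc p) (x + + 1)) (ℤP.≤-reflexive (trans (cong h (lemma x (+ p))) (difference-periodic g G x))))
      (h-step x)
      where
      lemma : ∀ x p → x + + 1 + (+ 1 + p) ≡ x + (+ 2 + p)
      lemma = solve-∀

  -- Without descents the inverse is increasing, hence a translation by some c; its drift is n times
  -- c, and vanishing drift forces c to be 0.
  no-descent⇒id : ∀ f → drift (to f) ≡ + 0 → ¬ (Σ (Fin n) λ k → from f (rep k + + 1) < from f (rep k)) →
    ∀ x → to f x ≡ x
  no-descent⇒id f d₀ none x = trans (cong (to f) (sym (from-id x))) (to-from f x)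
    where
    g = from f
    rising : ∀ x → g x + + 1 ≤ g (x + + 1)
    rising x = <⇒1+≤ (ℤP.≤∧≢⇒< (ℤP.≮⇒≥ not-falling) (λ eq → ℤP.i≢suc[i] (trans (to-injective (f ⁻¹ᵇ) eq) (ℤP.+-comm x (+ 1)))))
      where
      t = - D (x - + 1)
      lemma₁ : ∀ x u → x + u + + 1 ≡ x + + 1 + u
      lemma₁ = solve-∀
      lemma₂ : ∀ a b u → b + u - (a + u) ≡ b - a
      lemma₂ = solve-∀
      not-falling : ¬ (g (x + + 1) < g x)
      not-falling lt = none (class x , subst₂ _<_
        (sym (trans (cong g (trans (cong (_+ + 1) (rep-class x)) (lemma₁ x (t * N)))) (equivariant-multiple g (from-+N f) (x + + 1) t)))
        (sym (trans (cong g (rep-class x)) (equivariant-multiple g (from-+N f) x t)))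
        (<-by-difference lt (lemma₂ (g (x + + 1)) (g x) (t * N))))
    translation : ∀ x → g x ≡ x + g (+ 0)
    translation = monotone-translation g (from-+N f) rising
    drift-g : drift g ≡ + 0
    drift-g = trans (sym (ℤP.+-identityˡ (drift g))) (trans (cong (_+ drift g) (sym d₀)) (drift-from f))
    N*g0 : N * g (+ 0) ≡ N * + 0
    N*g0 = begin
      N * g (+ 0)             ≡⟨ ℤP.+-identityˡ (N * g (+ 0)) ⟨
      + 0 + N * g (+ 0)       ≡⟨ cong (_+ N * g (+ 0)) drift-id ⟨
      drift id + N * g (+ 0)  ≡⟨ drift-+ id (g (+ 0)) ⟨
      drift (_+ g (+ 0))      ≡⟨ drift-cong {g} translation ⟨
      drift g                 ≡⟨ drift-g ⟩
      + 0                     ≡⟨ ℤP.*-zeroʳ N ⟨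
      N * + 0                 ∎
      where open ≡-Reasoning
    from-id : ∀ x → g x ≡ x
    from-id x = trans (translation x) (trans (cong (λ u → x + u) (ℤP.*-cancelˡ-≡ N (g (+ 0)) (+ 0) N*g0)) (ℤP.+-identityʳ x))

  Descent : Bijection → Set
  Descent f = Σ (Fin n) λ k → from f (rep k + + 1) < from f (rep k)

  descent? : ∀ f → Dec (Descent f)
  descent? f = FinP.any? (λ k → from f (rep k + + 1) ℤP.<? from f (rep k))

  -- Only the upper bound on the length is recorded: `‖‖≤2*length` gives the opposite one for every
  -- word.
  record ReducedWord (f : Bijection) : Set where
    constructor reduced
    field
      letters : List (Fin n)
      length≤ : 2 ℕ.* length letters ℕ.≤ ‖ f ‖
      spells  : to f ≗ℤ prod n letters

  extend : ∀ f → (k : Fin n) → from f (rep k + + 1) < from f (rep k) →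
    ReducedWord (gen (suc (toℕ k)) ∘ᵇ f) → ReducedWord f
  extend f k lt (reduced ws len eq) = reduced (k ∷ ws)
    (begin
      2 ℕ.* suc (length ws)                   ≡⟨ trans (ℕP.*-suc 2 (length ws)) (ℕP.+-comm 2 (2 ℕ.* length ws)) ⟩
      2 ℕ.* length ws ℕ.+ 2                   ≤⟨ ℕP.+-monoˡ-≤ 2 len ⟩
      ‖ gen (suc (toℕ k)) ∘ᵇ f ‖ ℕ.+ 2        ≤⟨ gen-descent f k lt ⟩
      ‖ f ‖                                   ∎)
    (λ x → trans (sym (gen-involutive (suc (toℕ k)) (to f x))) (cong (genℕ n (suc (toℕ k))) (eq x)))
    where open ℕP.≤-Reasoning

  -- The number `m` is fuel bounding the norm. One unit per letter is enough, since each descent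
  -- lowers the norm by two.
  reduced-word : ∀ m f → drift (to f) ≡ + 0 → ‖ f ‖ ℕ.≤ m → ReducedWord f
  search : ∀ m f → drift (to f) ≡ + 0 → ‖ f ‖ ℕ.≤ m → Dec (Descent f) → ReducedWord f

  reduced-word m f d₀ le = search m f d₀ le (descent? f)

  search m f d₀ le (no none) = reduced [] ℕ.z≤n (no-descent⇒id f d₀ none)
  search zero f d₀ le (yes (k , lt)) =
    contradiction (ℕP.≤-trans (ℕP.m≤n+m 2 ‖ gen (suc (toℕ k)) ∘ᵇ f ‖) (ℕP.≤-trans (gen-descent f k lt) le)) λ ()
  search (suc m) f d₀ le (yes (k , lt)) = extend f k lt (reduced-word m f′ drift-f′ shorter)
    where
    open ℕP.≤-Reasoning
    f′ = gen (suc (toℕ k)) ∘ᵇ f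
    drift-f′ : drift (to f′) ≡ + 0
    drift-f′ = trans (drift-∘ (genℕ n (suc (toℕ k))) (gen-+N (suc (toℕ k))) f) (cong₂ _+_ (drift-gen (suc (toℕ k))) d₀)
    shorter : ‖ f′ ‖ ℕ.≤ m
    shorter = ℕP.≤-pred (begin
      suc ‖ f′ ‖       ≡⟨ ℕP.+-comm 1 ‖ f′ ‖ ⟩
      ‖ f′ ‖ ℕ.+ 1     ≤⟨ ℕP.+-monoʳ-≤ ‖ f′ ‖ (ℕP.n≤1+n 1) ⟩
      ‖ f′ ‖ ℕ.+ 2     ≤⟨ gen-descent f k lt ⟩
      ‖ f ‖            ≤⟨ le ⟩
      suc m            ∎)

  ‖‖≤2*length : ∀ f (ws : List (Fin n)) → to f ≗ℤ prod n ws → ‖ f ‖ ℕ.≤ 2 ℕ.* length ws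
  ‖‖≤2*length f ws eq = begin
    ‖ f ‖                   ≡⟨ ‖‖-cong {f} {word is} (λ x → trans (eq x) (sym (to-word is x))) ⟩
    ‖ word is ‖             ≤⟨ ‖word‖ is ⟩
    2 ℕ.* length is         ≡⟨ cong (2 ℕ.*_) (ListP.length-map (λ k → suc (toℕ k)) ws) ⟩
    2 ℕ.* length ws         ∎
    where
    open ℕP.≤-Reasoning
    is = map (λ k → suc (toℕ k)) ws

  ‖‖⇒HasLength : ∀ f → drift (to f) ≡ + 0 → ∀ k → ‖ f ‖ ≡ 2 ℕ.* k → HasLength n (to f) k
  ‖‖⇒HasLength f d₀ k eq with reduced-word ‖ f ‖ f d₀ ℕP.≤-refl
  ... | reduced ws len f≗ws = (ws , ℕP.≤-antisym (ℕP.*-cancelˡ-≤ 2 (ℕP.≤-trans len (ℕP.≤-reflexive eq))) (minimal ws f≗ws) , f≗ws) , minimal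
    where
    minimal : ∀ ws → to f ≗ℤ prod n ws → k ℕ.≤ length ws
    minimal ws f≗ws = ℕP.*-cancelˡ-≤ 2 (ℕP.≤-trans (ℕP.≤-reflexive (sym eq)) (‖‖≤2*length f ws f≗ws))

  HasLength⇒‖‖ : ∀ f → drift (to f) ≡ + 0 → ∀ k → HasLength n (to f) k → ‖ f ‖ ≡ 2 ℕ.* k
  HasLength⇒‖‖ f d₀ k ((ws , refl , f≗ws) , minimal) with reduced-word ‖ f ‖ f d₀ ℕP.≤-refl
  ... | reduced vs len f≗vs = ℕP.≤-antisym (‖‖≤2*length f ws f≗ws) (ℕP.≤-trans (ℕP.*-monoʳ-≤ 2 (minimal vs f≗vs)) len)

  -- That the norm is even comes from the reduced word, whose length is squeezed to half of it.
  has-length : ∀ f → drift (to f) ≡ + 0 → Σ ℕ (HasLength n (to f))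
  has-length f d₀ with reduced-word ‖ f ‖ f d₀ ℕP.≤-refl
  ... | reduced ws len f≗ws = length ws , ‖‖⇒HasLength f d₀ (length ws) (ℕP.≤-antisym (‖‖≤2*length f ws f≗ws) len)

  -- The sum condition of `AffPerm` as vanishing drift

  sumTo-suc : ∀ f m → sumTo f (suc m) ≡ f 1 + sumTo (f ∘ suc) m
  sumTo-suc f zero    = ℤP.+-comm (+ 0) (f 1)
  sumTo-suc f (suc m) = trans (cong (_+ f (suc (suc m))) (sumTo-suc f m)) (ℤP.+-assoc (f 1) (sumTo (f ∘ suc) m) (f (suc (suc m))))

  sumTo-sum : ∀ f m → sumTo f m ≡ ℤSum.sum {m} (λ i → f (suc (toℕ i)))
  sumTo-sum f zero    = refl
  sumTo-sum f (suc m) = trans (sumTo-suc f m) (cong (λ s → f 1 + s) (sumTo-sum (f ∘ suc) m))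

  drift-sumTo : ∀ f → sumTo (λ i → f (+ i)) n ≡ drift f + sumTo (λ i → + i) n
  drift-sumTo f = begin
    sumTo (λ i → f (+ i)) n              ≡⟨ sumTo-sum (λ i → f (+ i)) n ⟩
    ℤSum.sum {n} (f ∘ rep)               ≡⟨ ℤ∑.∑-unfold f ⟨
    ℤ∑.∑ f                               ≡⟨ ℤ∑.∑-cong (λ x → lemma (f x) x) ⟩
    ℤ∑.∑ (λ x → f x - x + x)             ≡⟨ ℤ∑.∑-+ (λ x → f x - x) id ⟩
    drift f + ℤ∑.∑ id                    ≡⟨ cong (λ s → drift f + s) (trans (ℤ∑.∑-unfold id) (sym (sumTo-sum (λ i → + i) n))) ⟩
    drift f + sumTo (λ i → + i) n        ∎
    where
    open ≡-Reasoning
    lemma : ∀ a x → a ≡ a - x + x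
    lemma = solve-∀

  bijection : AffPerm n → Bijection
  bijection z = record
    { to = fun z ; from = inv z ; from-to = inv-fun z ; to-from = fun-inv z ; to-+N = periodic z }

  drift-fun : ∀ (z : AffPerm n) → drift (fun z) ≡ + 0
  drift-fun z = ℤG.∙-cancelʳ (sumTo (λ i → + i) n) (drift (fun z)) (+ 0)
    (trans (sym (drift-sumTo (fun z))) (trans (sum-cond z) (sym (ℤP.+-identityˡ (sumTo (λ i → + i) n)))))

  affPerm : ∀ f → drift (to f) ≡ + 0 → AffPerm n
  affPerm f d₀ = record
    { fun = to f ; inv = from f ; inv-fun = from-to f ; fun-inv = to-from f ; periodic = to-+N f
    ; sum-cond = trans (drift-sumTo (to f)) (trans (cong (_+ sumTo (λ i → + i) n) d₀) (ℤP.+-identityˡ (sumTo (λ i → + i) n))) }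

  -- A periodic bijection permutes the residues modulo n, so only the displacement of
  -- the windows contributes to its drift.
  drift-displacement : ∀ f → drift (to f) ≡ ℤ∑.∑ (λ x → D (to f x - + 1)) * N
  drift-displacement f = begin
    drift (to f)                                          ≡⟨ ℤ∑.∑-cong split ⟩
    ℤ∑.∑ (λ x → h x * N + (r (to f x) - x))               ≡⟨ ℤ∑.∑-+ (λ x → h x * N) (λ x → r (to f x) - x) ⟩
    ℤ∑.∑ (λ x → h x * N) + ℤ∑.∑ (λ x → r (to f x) - x)    ≡⟨ cong₂ _+_ scaled permuted ⟩
    ℤ∑.∑ h * N + + 0                                      ≡⟨ ℤP.+-identityʳ (ℤ∑.∑ h * N) ⟩
    ℤ∑.∑ h * N                                            ∎
    where
    open ≡-Reasoning
    h r neg : ℤ → ℤ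
    h x = D (to f x - + 1)
    r x = rep (class x)
    neg x = - x
    split : ∀ x → to f x - x ≡ h x * N + (r (to f x) - x)
    split x = trans (lemma (to f x) (h x) N x) (cong (λ u → h x * N + (u - x)) (sym (rep-class (to f x))))
      where
      lemma : ∀ y d m x → y - x ≡ d * m + (y + (- d) * m - x)
      lemma = solve-∀
    r-periodic : ∀ x → r (x + N) ≡ r x
    r-periodic x = trans (rep-class (x + N)) (trans (cong (λ d → x + N + (- d) * N) D-+N) (trans (lemma x (D (x - + 1)) N) (sym (rep-class x))))
      where
      lemma₀ : ∀ x m → x + m - + 1 ≡ x - + 1 + + 1 * m
      lemma₀ = solve-∀
      D-+N : D (x + N - + 1) ≡ D (x - + 1) + + 1
      D-+N = trans (cong D (lemma₀ x N)) (D-shift (x - + 1) (+ 1))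
      lemma : ∀ x d m → x + m + (- (d + + 1)) * m ≡ x + (- d) * m
      lemma = solve-∀
    scaled : ℤ∑.∑ (λ x → h x * N) ≡ ℤ∑.∑ h * N
    scaled = trans (ℤ∑.∑-unfold (λ x → h x * N)) (trans (sym (ℤSum.*-distribʳ-sum {n} N (h ∘ rep))) (cong (_* N) (sym (ℤ∑.∑-unfold h))))
    permuted : ℤ∑.∑ (λ x → r (to f x) - x) ≡ + 0
    permuted = begin
      ℤ∑.∑ (λ x → r (to f x) - x)                    ≡⟨ ℤ∑.∑-+ (λ x → r (to f x)) neg ⟩
      ℤ∑.∑ (λ x → r (to f x)) + ℤ∑.∑ neg             ≡⟨ cong (λ u → u + ℤ∑.∑ neg) (ℤ∑.∑-reindex r r-periodic f) ⟩
      ℤ∑.∑ r + ℤ∑.∑ neg                              ≡⟨ ℤ∑.∑-+ r neg ⟨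
      ℤ∑.∑ (λ x → r x - x)                           ≡⟨ ℤ∑.∑-unfold (λ x → r x - x) ⟩
      ℤSum.sum {n} (λ i → r (rep i) - rep i)         ≡⟨ ℤSum.sum-cong-≗ {n} (λ i → trans (cong (λ j → rep j - rep i)
          (class-of-rep i)) (ℤP.+-inverseʳ (rep i))) ⟩
      ℤSum.sum {n} (λ _ → + 0)                       ≡⟨ trans (zsum-const n (+ 0)) (ℤP.*-zeroʳ N) ⟩
      + 0                                            ∎
      where
      class-of-rep : ∀ i → class (rep i) ≡ i
      class-of-rep i = trans (cong class (sym (ℤP.+-identityʳ (rep i)))) (class-rep i (+ 0))

  residue-unique : ∀ {a b} → a ℕ.< n → b ℕ.< n → Multiple (+ a - + b) → a ≡ b
  residue-unique {a} {b} a<n b<n (t , eq) = trans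
    (sym (%-unique {+ a} {a} (+ 0) a<n (sym (ℤP.+-identityʳ (+ a)))))
    (%-unique {+ a} {b} t b<n (trans (lemma (+ a) (+ b)) (cong (λ s → + b + s) eq)))
    where
    lemma : ∀ a b → a ≡ b + (a - b)
    lemma = solve-∀

  bit : Bool → ℕ
  bit false = 0
  bit true  = 1

  double+bit-injective : ∀ s t b c → 2 ℕ.* s ℕ.+ bit b ≡ 2 ℕ.* t ℕ.+ bit c → s ≡ t
  double+bit-injective s t false false eq = ℕP.*-cancelˡ-≡ s t 2 (ℕP.+-cancelʳ-≡ 0 (2 ℕ.* s) (2 ℕ.* t) eq)
  double+bit-injective s t true  true  eq = ℕP.*-cancelˡ-≡ s t 2 (ℕP.+-cancelʳ-≡ 1 (2 ℕ.* s) (2 ℕ.* t) eq)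
  double+bit-injective s t false true  eq = contradiction (trans (sym (ℕP.+-identityʳ (2 ℕ.* s))) (trans eq (ℕP.+-comm
      (2 ℕ.* t) 1))) (ℕP.even≢odd s t)
  double+bit-injective s t true  false eq = contradiction (trans (sym (ℕP.+-identityʳ (2 ℕ.* t))) (trans (sym eq) (ℕP.+-comm
      (2 ℕ.* s) 1))) (ℕP.even≢odd t s)

  double+bit-< : ∀ t b l → t ℕ.< l → 2 ℕ.* t ℕ.+ bit b ℕ.< l ℕ.* 2
  double+bit-< t b l t<l = begin-strict
    2 ℕ.* t ℕ.+ bit b   <⟨ ℕP.+-monoʳ-< (2 ℕ.* t) (bit<2 b) ⟩
    2 ℕ.* t ℕ.+ 2       ≡⟨ trans (ℕP.+-comm (2 ℕ.* t) 2) (sym (ℕP.*-suc 2 t)) ⟩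
    2 ℕ.* suc t         ≤⟨ ℕP.*-monoʳ-≤ 2 t<l ⟩
    2 ℕ.* l             ≡⟨ ℕP.*-comm 2 l ⟩
    l ℕ.* 2             ∎
    where
    open ℕP.≤-Reasoning
    bit<2 : ∀ b → bit b ℕ.< 2
    bit<2 false = ℕ.s≤s ℕ.z≤n
    bit<2 true  = ℕ.s≤s (ℕ.s≤s ℕ.z≤n)

  -- The fixed-point-free involutions Θ⁺ = Θ 1 and Θ⁻ = Θ 2

  module Even (l : ℕ) (n≡l*2 : n ≡ l ℕ.* 2) where

    L : ℤ
    L = + l

    N≡L*2 : N ≡ L * + 2
    N≡L*2 = trans (cong +_ n≡l*2) (ℤP.pos-* l 2)

    instance
      l-nonZero : NonZero l
      l-nonZero = ℕ.≢-nonZero λ where refl → contradiction n≡l*2 λ ()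

    Θ : ℕ → ℤ → ℤ
    Θ c = prodℕ n (map (λ t → c ℕ.+ 2 ℕ.* t) (upTo l))

    -- Coordinates adapted to `Θ c`: the q-th block of two consecutive integers, counted from c, and
    -- the position inside it. In these coordinates `Θ c` negates the bit.
    point : ℕ → ℤ → Bool → ℤ
    point c q b = + c + (+ 2 * q + + bit b)

    -- The base `c` cancels, so congruence modulo n is decided by the positions `2t + b` and
    -- `2t′ + e`, which lie in [0, n) when `t` and `t′` are below `l` and the bits are at most 1.
    point-difference : ∀ c t k b t′ e → point c (+ t + k * L) b - (+ (c ℕ.+ 2 ℕ.* t′) + + e) ≡ + (2 ℕ.* t ℕ.+ bit b) - + (2 ℕ.* t′ ℕ.+ e) + k * N
    point-difference c t k b t′ e = begin
      + c + (+ 2 * (+ t + k * L) + + bit b) - (+ c + + (2 ℕ.* t′) + + e)          ≡⟨ cong (λ u → + c + (+ 2 *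
          (+ t + k * L) + + bit b) - (+ c + u + + e)) (ℤP.pos-* 2 t′) ⟩
      + c + (+ 2 * (+ t + k * L) + + bit b) - (+ c + + 2 * + t′ + + e)            ≡⟨ lemma (+ c) (+ t) k L (+ bit b) (+ t′) (+ e) ⟩
      (+ 2 * + t + + bit b) - (+ 2 * + t′ + + e) + k * (L * + 2)                  ≡⟨ cong₂ (λ u v → u + + bit b -
          (v + + e) + k * (L * + 2)) (ℤP.pos-* 2 t) (ℤP.pos-* 2 t′) ⟨
      + (2 ℕ.* t ℕ.+ bit b) - + (2 ℕ.* t′ ℕ.+ e) + k * (L * + 2)                  ≡⟨ cong (λ u → + (2 ℕ.* t ℕ.+ bit b) - +
          (2 ℕ.* t′ ℕ.+ e) + k * u) N≡L*2 ⟨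
      + (2 ℕ.* t ℕ.+ bit b) - + (2 ℕ.* t′ ℕ.+ e) + k * N                          ∎
      where
      open ≡-Reasoning
      lemma : ∀ c t k l b t′ e → c + (+ 2 * (t + k * l) + b) - (c + + 2 * t′ + e) ≡ (+ 2 * t + b) - (+ 2 * t′ + e) + k * (l * + 2)
      lemma = solve-∀

    point-multiple : ∀ c t k b e → bit b ≡ e → Multiple (point c (+ t + k * L) b - (+ (c ℕ.+ 2 ℕ.* t) + + e))
    point-multiple c t k b e refl = k , trans (point-difference c t k b t e) (lemma (+ (2 ℕ.* t ℕ.+ e)) (k * N))
      where
      lemma : ∀ a u → a - a + u ≡ u
      lemma = solve-∀

    point-not-multiple : ∀ c t k b t′ b′ → t ℕ.< l → t′ ℕ.< l → t′ ≢ t →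
      ¬ Multiple (point c (+ t + k * L) b - (+ (c ℕ.+ 2 ℕ.* t′) + + bit b′))
    point-not-multiple c t k b t′ b′ t<l t′<l t′≢t m = t′≢t (sym (double+bit-injective t t′ b b′ (residue-unique
        (bound t b t<l) (bound t′ b′ t′<l)
      (Multiple-by (Multiple-difference m (k , refl)) (trans (lemma (+ (2 ℕ.* t ℕ.+ bit b) - + (2 ℕ.* t′ ℕ.+ bit b′))
          (k * N)) (cong (_- k * N) (sym (point-difference c t k b t′ (bit b′)))))))))
      where
      bound : ∀ t b → t ℕ.< l → 2 ℕ.* t ℕ.+ bit b ℕ.< n
      bound t b t<l = subst (2 ℕ.* t ℕ.+ bit b ℕ.<_) (sym n≡l*2) (double+bit-< t b l t<l)
      lemma : ∀ a u → a ≡ a + u - u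
      lemma = solve-∀

    gen-swaps-point : ∀ c t k b → genℕ n (c ℕ.+ 2 ℕ.* t) (point c (+ t + k * L) b) ≡ point c (+ t + k * L) (not b)
    gen-swaps-point c t k false = trans (gen-at (c ℕ.+ 2 ℕ.* t) (point c (+ t + k * L) false)
        (Multiple-by (point-multiple c t k false 0 refl) (cong (λ u → point c (+ t + k * L) false - u) (sym (ℤP.+-identityʳ
            (+ (c ℕ.+ 2 ℕ.* t)))))))
      (lemma (+ c) (+ 2 * (+ t + k * L)))
      where
      lemma : ∀ c q → c + (q + + 0) + + 1 ≡ c + (q + + 1)
      lemma = solve-∀
    gen-swaps-point c t k true = trans (gen-next (c ℕ.+ 2 ℕ.* t) (point c (+ t + k * L) true) (point-multiple c t k true 1 refl))
      (lemma (+ c) (+ 2 * (+ t + k * L)))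
      where
      lemma : ∀ c q → c + (q + + 1) - + 1 ≡ c + (q + + 0)
      lemma = solve-∀

    gen-fixes-point : ∀ c t k b t′ → t ℕ.< l → t′ ℕ.< l → t′ ≢ t → genℕ n (c ℕ.+ 2 ℕ.* t′) (point c (+ t + k * L) b) ≡ point c (+ t + k * L) b
    gen-fixes-point c t k b t′ t<l t′<l t′≢t = gen-other (c ℕ.+ 2 ℕ.* t′) (point c (+ t + k * L) b)
      (λ m → point-not-multiple c t k b t′ false t<l t′<l t′≢t (Multiple-by m (cong (λ u → point c (+ t + k * L) b - u)
          (ℤP.+-identityʳ (+ (c ℕ.+ 2 ℕ.* t′))))))
      (point-not-multiple c t k b t′ true t<l t′<l t′≢t)

    blocks-fix-point : ∀ c t k b → t ℕ.< l → ∀ {ts} → All (_≢ t) ts → All (ℕ._< l) ts →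
      prodℕ n (map (λ t → c ℕ.+ 2 ℕ.* t) ts) (point c (+ t + k * L) b) ≡ point c (+ t + k * L) b
    blocks-fix-point c t k b t<l [] [] = refl
    blocks-fix-point c t k b t<l {t′ ∷ ts} (t′≢t ∷ ≢t) (t′<l ∷ <l) =
      trans (cong (genℕ n (c ℕ.+ 2 ℕ.* t′)) (blocks-fix-point c t k b t<l ≢t <l)) (gen-fixes-point c t k b t′ t<l t′<l t′≢t)

    -- Exactly one factor has index `t` and swaps the two entries of the block; before and after it
    -- the value stays in that block, which all other factors fix.
    blocks-swap-point : ∀ c t k b → t ℕ.< l → ∀ {ts} → t ∈ ts → Unique ts → All (ℕ._< l) ts →
      prodℕ n (map (λ t → c ℕ.+ 2 ℕ.* t) ts) (point c (+ t + k * L) b) ≡ point c (+ t + k * L) (not b)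
    blocks-swap-point c t k b t<l (here refl) (t≢ ∷ _) (_ ∷ <l) =
      trans (cong (genℕ n (c ℕ.+ 2 ℕ.* t)) (blocks-fix-point c t k b t<l (All.map (λ ne eq → ne (sym eq)) t≢) <l)) (gen-swaps-point c t k b)
    blocks-swap-point c t k b t<l {t′ ∷ ts} (there t∈) (t′≢ ∷ unique) (t′<l ∷ <l) =
      trans (cong (genℕ n (c ℕ.+ 2 ℕ.* t′)) (blocks-swap-point c t k b t<l t∈ unique <l))
        (gen-fixes-point c t k (not b) t′ t<l t′<l (All.lookup t′≢ t∈))

    Θ-point : ∀ c q b → Θ c (point c q b) ≡ point c q (not b)
    Θ-point c q b = subst (λ q → Θ c (point c q b) ≡ point c q (not b)) (sym (a≡a%ℕn+[a/ℕn]*n q l))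
      (blocks-swap-point c (q %ℕ l) (q /ℕ l) b (n%ℕd<d q l) (∈-upTo⁺ (n%ℕd<d q l)) (upTo⁺ l) (All.tabulate ∈-upTo⁻))

    point-surjective : ∀ c x → Σ ℤ λ q → Σ Bool λ b → x ≡ point c q b
    point-surjective c x = go ((x - + c) %ℕ 2) (n%ℕd<d (x - + c) 2) (a≡a%ℕn+[a/ℕn]*n (x - + c) 2)
      where
      q = (x - + c) /ℕ 2
      lemma₁ : ∀ x c → x ≡ x - c + c
      lemma₁ = solve-∀
      lemma₂ : ∀ r q c → r + q * + 2 + c ≡ c + (+ 2 * q + r)
      lemma₂ = solve-∀
      go : ∀ r → r ℕ.< 2 → x - + c ≡ + r + q * + 2 → Σ ℤ λ q → Σ Bool λ b → x ≡ point c q b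
      go 0 _ eq = q , false , trans (lemma₁ x (+ c)) (trans (cong (_+ + c) eq) (lemma₂ (+ 0) q (+ c)))
      go 1 _ eq = q , true  , trans (lemma₁ x (+ c)) (trans (cong (_+ + c) eq) (lemma₂ (+ 1) q (+ c)))
      go (suc (suc _)) (ℕ.s≤s (ℕ.s≤s ())) eq

    Θᵇ : ℕ → Bijection
    Θᵇ c = word (map (λ t → c ℕ.+ 2 ℕ.* t) (upTo l))

    to-Θᵇ : ∀ c x → to (Θᵇ c) x ≡ Θ c x
    to-Θᵇ c = to-word (map (λ t → c ℕ.+ 2 ℕ.* t) (upTo l))

    ‖Θᵇ‖ : ∀ c → ‖ Θᵇ c ‖ ℕ.≤ n
    ‖Θᵇ‖ c = ℕP.≤-trans (‖word‖ (map (λ t → c ℕ.+ 2 ℕ.* t) (upTo l)))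
      (ℕP.≤-reflexive (trans (cong (2 ℕ.*_) (trans (ListP.length-map (λ t → c ℕ.+ 2 ℕ.* t) (upTo l)) (ListP.length-upTo l)))
          (trans (ℕP.*-comm 2 l) (sym n≡l*2))))

    -- Conjugators of Θ, and the non-conjugacy of Θ⁺ and Θ⁻

    Conjugates : ℕ → Bijection → Bijection → Set
    Conjugates c w z = ∀ x → from w (Θ c (to w x)) ≡ to z x

    -- Norms are doubled lengths, so the n/2 letters of Θ appear as the summand `n`.
    ‖conjugate‖ : ∀ c w z → Conjugates c w z → ‖ z ‖ ℕ.≤ 2 ℕ.* ‖ w ‖ ℕ.+ n
    ‖conjugate‖ c w z conj = begin
      ‖ z ‖                                       ≡⟨ ‖‖-cong {z} {w ⁻¹ᵇ ∘ᵇ Θᵇ c ∘ᵇ w} (λ x → trans (sym (conj x)) (cong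
          (from w) (sym (to-Θᵇ c (to w x))))) ⟩
      ‖ w ⁻¹ᵇ ∘ᵇ Θᵇ c ∘ᵇ w ‖                      ≤⟨ ‖∘‖ (w ⁻¹ᵇ) (Θᵇ c ∘ᵇ w) ⟩
      ‖ w ⁻¹ᵇ ‖ ℕ.+ ‖ Θᵇ c ∘ᵇ w ‖                 ≤⟨ ℕP.+-monoʳ-≤ ‖ w ⁻¹ᵇ ‖ (‖∘‖ (Θᵇ c) w) ⟩
      ‖ w ⁻¹ᵇ ‖ ℕ.+ (‖ Θᵇ c ‖ ℕ.+ ‖ w ‖)          ≤⟨ ℕP.+-mono-≤ (ℕP.≤-reflexive (‖⁻¹‖ w)) (ℕP.+-monoˡ-≤ ‖ w ‖ (‖Θᵇ‖ c)) ⟩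
      ‖ w ‖ ℕ.+ (n ℕ.+ ‖ w ‖)                     ≡⟨ lemma ‖ w ‖ n ⟩
      2 ℕ.* ‖ w ‖ ℕ.+ n                           ∎
      where
      open ℕP.≤-Reasoning
      lemma : ∀ a m → a ℕ.+ (m ℕ.+ a) ≡ 2 ℕ.* a ℕ.+ m
      lemma = ℕS.solve-∀

    odd-not-even : ∀ a b → + 2 * a + + 1 ≢ + 2 * b
    odd-not-even a b eq = ℕP.even≢odd ∣ b - a ∣ 0 (trans (sym (ℤP.abs-* (+ 2) (b - a))) (cong ∣_∣ (trans (lemma b a) (trans
        (cong (_- + 2 * a) (sym eq)) (lemma′ a)))))
      where
      lemma : ∀ b a → + 2 * (b - a) ≡ + 2 * b - + 2 * a
      lemma = solve-∀
      lemma′ : ∀ a → + 2 * a + + 1 - + 2 * a ≡ + 1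
      lemma′ = solve-∀

    even-sum : ∀ m {k} → k ≡ m ℕ.* 2 → (g : ℕ → ℤ) → (∀ s → g (2 ℕ.* s) ≡ g (suc (2 ℕ.* s))) →
      Σ ℤ λ u → ℤSum.sum {k} (g ∘ toℕ) ≡ + 2 * u
    even-sum zero    refl g pairs = + 0 , refl
    even-sum (suc m) refl g pairs with even-sum m refl (g ∘ suc ∘ suc) (λ s → subst (λ k → g k ≡ g (suc k)) (ℕP.*-suc 2 s) (pairs (suc s)))
    ... | u , eq = g 0 + u , trans (cong₂ (λ a b → g 0 + (a + b)) (sym (pairs 0)) eq) (lemma (g 0) u)
      where
      lemma : ∀ a u → a + (a + + 2 * u) ≡ + 2 * (a + u)
      lemma = solve-∀

    -- Blocks {1 + 2q, 2 + 2q} never straddle a multiple of n, so both entries of a block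
    -- contribute equally to the total displacement.
    drift-commuting : ∀ (t : Bijection) → (∀ x → to t (Θ 1 x) ≡ Θ 1 (to t x)) → Σ ℤ λ u → drift (to t) ≡ + 2 * u * N
    drift-commuting t comm = proj₁ even , trans (drift-displacement t)
      (cong (_* N) (trans (ℤ∑.∑-unfold h) (proj₂ even)))
      where
      E h : ℤ → ℤ
      E y = D (y - + 1)
      h x = E (to t x)
      E-Θ : ∀ y → E (Θ 1 y) ≡ E y
      E-Θ y with point-surjective 1 y
      ... | q , b , refl = trans (cong E (Θ-point 1 q b)) (E-not b)
        where
        ¬mult : ¬ Multiple (+ 2 * q + + 0 + + 1)
        ¬mult (k , eq) = odd-not-even q (k * L) (trans (cong (_+ + 1) (sym (ℤP.+-identityʳ (+ 2 * q)))) (trans eq (trans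
            (cong (k *_) N≡L*2) (lemma k L))))
          where
          lemma : ∀ k l → k * (l * + 2) ≡ + 2 * (k * l)
          lemma = solve-∀
        lemma₀ : ∀ q b → + 1 + (q + b) - + 1 ≡ q + b
        lemma₀ = solve-∀
        lemma₁ : ∀ q → + 1 + (q + + 1) - + 1 ≡ q + + 0 + + 1
        lemma₁ = solve-∀
        same : E (point 1 q true) ≡ E (point 1 q false)
        same = trans (cong D (lemma₁ (+ 2 * q))) (trans (D-suc (+ 2 * q + + 0) ¬mult) (cong D (sym (lemma₀ (+ 2 * q) (+ 0)))))
        E-not : ∀ b → E (point 1 q (not b)) ≡ E (point 1 q b)
        E-not false = same
        E-not true  = sym same
      pairs : ∀ s → h (+ suc (2 ℕ.* s)) ≡ h (+ suc (suc (2 ℕ.* s)))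
      pairs s = trans (sym (E-Θ (to t (+ suc (2 ℕ.* s))))) (trans (cong E (sym (comm (+ suc (2 ℕ.* s)))))
        (cong h (trans (cong (Θ 1) (lemma false)) (trans (Θ-point 1 (+ s) false) (trans (cong (λ u → + 1 + (u + + 1)) (sym
            (ℤP.pos-* 2 s))) (cong (λ k → + suc k) (ℕP.+-comm (2 ℕ.* s) 1)))))))
        where
        lemma : ∀ b → + suc (2 ℕ.* s) ≡ point 1 (+ s) false
        lemma b = trans (cong (λ k → + suc k) (sym (ℕP.+-identityʳ (2 ℕ.* s)))) (cong (λ u → + 1 + (u + + 0)) (ℤP.pos-* 2 s))
      even : Σ ℤ λ u → ℤSum.sum {n} (λ i → h (rep i)) ≡ + 2 * u
      even = even-sum l n≡l*2 (λ k → h (+ suc k)) pairs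

    not-conjugate-to-both : ∀ w v z → drift (to w) ≡ + 0 → drift (to v) ≡ + 0 → Conjugates 1 w z → ¬ Conjugates 2 v z
    not-conjugate-to-both w v z dw dv cw cv = ℕP.even≢odd ∣ u ∣ 0 (trans (sym (ℤP.abs-* (+ 2) u)) (cong ∣_∣ (ℤP.*-cancelʳ-≡ (+ 2 * u) (+ 1) N
        (trans (sym (proj₂ even)) (trans drift-t (sym (ℤP.*-identityˡ N)))))))
      where
      open ≡-Reasoning
      wv = w ∘ᵇ v ⁻¹ᵇ
      -- The translation carries Θ⁺ to Θ⁻ and `wv` carries Θ⁻ back to Θ⁺, so `t` commutes with Θ⁺.
      -- The factors `w` and `v` have drift zero, which leaves the drift n of the translation.
      t = wv ∘ᵇ translate (+ 1)
      Θ-shift : ∀ x → Θ 1 x + + 1 ≡ Θ 2 (x + + 1)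
      Θ-shift x with point-surjective 1 x
      ... | q , b , refl = trans (cong (_+ + 1) (Θ-point 1 q b)) (trans (shift (not b)) (trans (sym (Θ-point 2 q b)) (cong
          (Θ 2) (sym (shift b)))))
        where
        lemma : ∀ y → + 1 + y + + 1 ≡ + 2 + y
        lemma = solve-∀
        shift : ∀ b → point 1 q b + + 1 ≡ point 2 q b
        shift b = lemma (+ 2 * q + + bit b)
      comm : ∀ x → to t (Θ 1 x) ≡ Θ 1 (to t x)
      comm x = begin
        to w (from v (Θ 1 x + + 1))                          ≡⟨ cong (to w ∘ from v) (Θ-shift x) ⟩
        to w (from v (Θ 2 (x + + 1)))                        ≡⟨ cong (to w ∘ from v ∘ Θ 2) (to-from v (x + + 1)) ⟨
        to w (from v (Θ 2 (to v (from v (x + + 1)))))        ≡⟨ cong (to w) (trans (cv (from v (x + + 1))) (sym (cw (from v (x + + 1))))) ⟩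
        to w (from w (Θ 1 (to w (from v (x + + 1)))))        ≡⟨ to-from w (Θ 1 (to t x)) ⟩
        Θ 1 (to t x)                                         ∎
      even = drift-commuting t comm
      u = proj₁ even
      drift-v⁻¹ : drift (from v) ≡ + 0
      drift-v⁻¹ = trans (sym (ℤP.+-identityˡ (drift (from v)))) (trans (cong (_+ drift (from v)) (sym dv)) (drift-from v))
      drift-t : drift (to t) ≡ N
      drift-t = begin
        drift (to t)                            ≡⟨ drift-∘ (to wv) (to-+N wv) (translate (+ 1)) ⟩
        drift (to wv) + drift (_+ + 1)          ≡⟨ cong₂ _+_ (drift-∘ (to w) (to-+N w) (v ⁻¹ᵇ)) (drift-+ id (+ 1)) ⟩
        drift (to w) + drift (from v) + (drift id + N * + 1) ≡⟨ cong₂ (λ a b → a + b + (drift id + N * + 1)) dw drift-v⁻¹ ⟩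
        + 0 + (drift id + N * + 1)              ≡⟨ cong (λ a → + 0 + (a + N * + 1)) drift-id ⟩
        + 0 + (+ 0 + N * + 1)                   ≡⟨ lemma N ⟩
        N                                       ∎
        where
        lemma : ∀ m → + 0 + (+ 0 + m * + 1) ≡ m
        lemma = solve-∀

    D-χ : ∀ a → D a ≡ D (a - + 1) + + χ a
    D-χ a with multiple? a
    ... | no ¬m        = trans (sym (D-pred a ¬m)) (trans (sym (ℤP.+-identityʳ (D (a - + 1)))) (cong (λ c → D (a - + 1) + + c) (sym (χ-no ¬m))))
    ... | yes (t , refl) = begin
        D (t * N)                           ≡⟨ trans (cong D (sym (ℤP.+-identityˡ (t * N)))) (D-remainder t (ℕ.s≤s ℕ.z≤n)) ⟩
        t                                   ≡⟨ lemma t ⟩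
        t - + 1 + + 1                       ≡⟨ cong₂ (λ u c → u + + c) (D-below-multiple t) (χ-yes {t * N} (t , refl)) ⟨
        D (t * N - + 1) + + χ (t * N)       ∎
      where
      open ≡-Reasoning
      lemma : ∀ t → t ≡ t - + 1 + + 1
      lemma = solve-∀

    -- The minimal and maximal atoms

    module Counting (P : ℤ → Bool) (P-+N : ∀ x → P (x + N) ≡ P x) (total : ∑ (bit ∘ P) ≡ l) where

      -- An antidifference of the indicator function of P: - D (r - x) is the signed
      -- number of elements of the class of r in the interval [r , x).
      opaque
        rank : ℤ → ℤ
        rank x = ℤ∑.∑ (λ r → - D (r - x) * + bit (P r))

        rank-unfold : ∀ x → rank x ≡ ℤ∑.∑ (λ r → - D (r - x) * + bit (P r))
        rank-unfold x = refl

      select : ∀ x → ∑ (λ r → χ (r - x) ℕ.* bit (P r)) ≡ bit (P x)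
      select x = begin
        ∑ (λ r → χ (r - x) ℕ.* bit (P r))    ≡⟨ ∑-cong pointwise ⟩
        ∑ (λ r → bit (P x) ℕ.* χ (r - x))    ≡⟨ ∑-*ˡ (bit (P x)) (λ r → χ (r - x)) ⟩
        bit (P x) ℕ.* ∑ (λ r → χ (r - x))    ≡⟨ cong (bit (P x) ℕ.*_) (∑χ x) ⟩
        bit (P x) ℕ.* 1                      ≡⟨ ℕP.*-identityʳ (bit (P x)) ⟩
        bit (P x)                            ∎
        where
        open ≡-Reasoning
        pointwise : ∀ r → χ (r - x) ℕ.* bit (P r) ≡ bit (P x) ℕ.* χ (r - x)
        pointwise r with multiple? (r - x)
        ... | no ¬m = trans (cong (ℕ._* bit (P r)) (χ-no ¬m)) (sym (trans (cong (bit (P x) ℕ.*_) (χ-no ¬m)) (ℕP.*-zeroʳ (bit (P x)))))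
        ... | yes (t , eq) = trans (ℕP.*-comm (χ (r - x)) (bit (P r))) (cong (λ b → bit b ℕ.* χ (r - x))
              (trans (cong P move) (periodic-multiple N P P-+N x t)))
          where
          lemma : ∀ r x → r ≡ x + (r - x)
          lemma = solve-∀
          move : r ≡ x + t * N
          move = trans (lemma r x) (cong (λ u → x + u) eq)

      -- Passing from `x` to `x + 1` lowers `D (r - x)` by one exactly when `r` is congruent to `x`,
      -- and `select` collects that single class.
      rank-suc : ∀ x → rank (x + + 1) ≡ rank x + + bit (P x)
      rank-suc x = begin
        rank (x + + 1)                                                                  ≡⟨ rank-unfold (x + + 1) ⟩
        ℤ∑.∑ (λ r → - D (r - (x + + 1)) * + bit (P r))                                  ≡⟨ ℤ∑.∑-cong pointwise ⟩
        ℤ∑.∑ (λ r → - D (r - x) * + bit (P r) + + (χ (r - x) ℕ.* bit (P r)))            ≡⟨ ℤ∑.∑-+ (λ r → - D (r - x) * + bit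
            (P r)) (λ r → + (χ (r - x) ℕ.* bit (P r))) ⟩
        ℤ∑.∑ (λ r → - D (r - x) * + bit (P r)) + ℤ∑.∑ (λ r → + (χ (r - x) ℕ.* bit
            (P r)))                               ≡⟨ cong₂ _+_ (sym (rank-unfold x)) (trans (∑-pos (λ r → χ (r - x) ℕ.* bit
            (P r))) (cong +_ (select x))) ⟩
        rank x + + bit (P x)                                                            ∎
        where
        open ≡-Reasoning
        lemma₁ : ∀ r x → r - (x + + 1) ≡ r - x - + 1
        lemma₁ = solve-∀
        lemma₂ : ∀ d c b → - d * b ≡ - (d + c) * b + c * b
        lemma₂ = solve-∀
        pointwise : ∀ r → - D (r - (x + + 1)) * + bit (P r) ≡ - D (r - x) * + bit (P r) + + (χ (r - x) ℕ.* bit (P r))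
        pointwise r = trans (cong (λ u → - D u * + bit (P r)) (lemma₁ r x)) (trans (lemma₂ (D (r - x - + 1)) (+ χ (r - x)) (+ bit (P r)))
          (cong₂ (λ u v → - u * + bit (P r) + v) (sym (D-χ (r - x))) (sym (ℤP.pos-* (χ (r - x)) (bit (P r))))))

      rank-+N : ∀ x → rank (x + N) ≡ rank x + L
      rank-+N x = begin
        rank (x + N)                                                   ≡⟨ rank-unfold (x + N) ⟩
        ℤ∑.∑ (λ r → - D (r - (x + N)) * + bit (P r))                   ≡⟨ ℤ∑.∑-cong pointwise ⟩
        ℤ∑.∑ (λ r → - D (r - x) * + bit (P r) + + bit (P r))           ≡⟨ ℤ∑.∑-+ (λ r → - D (r - x) * + bit (P r)) (λ r → + bit (P r)) ⟩
        ℤ∑.∑ (λ r → - D (r - x) * + bit (P r)) + ℤ∑.∑ (λ r → + bit (P r))                              ≡⟨ cong₂ _+_ (sym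
            (rank-unfold x)) (trans (∑-pos (bit ∘ P)) (cong +_ total)) ⟩
        rank x + L                                                     ∎
        where
        open ≡-Reasoning
        lemma : ∀ d b → - (d - + 1) * b ≡ - d * b + b
        lemma = solve-∀
        pointwise : ∀ r → - D (r - (x + N)) * + bit (P r) ≡ - D (r - x) * + bit (P r) + + bit (P r)
        pointwise r = trans (cong (λ d → - d * + bit (P r)) (D-difference-+Nˡ id (λ _ → refl) x r)) (lemma (D (r - x)) (+ bit (P r)))

      rank-suc-true : ∀ {x} → P x ≡ true → rank (x + + 1) ≡ rank x + + 1
      rank-suc-true {x} eq = trans (rank-suc x) (cong (λ b → rank x + + bit b) eq)

      rank-suc-false : ∀ {x} → P x ≡ false → rank (x + + 1) ≡ rank x
      rank-suc-false {x} eq = trans (rank-suc x) (trans (cong (λ b → rank x + + bit b) eq) (ℤP.+-identityʳ (rank x)))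

      rank-mono : ∀ {x y} → x ≤ y → rank x ≤ rank y
      rank-mono {x} {y} x≤y = subst (λ u → rank x ≤ rank u) (trans (cong (λ u → x + u) (ℤP.0≤i⇒+∣i∣≡i (ℤP.i≤j⇒0≤j-i x≤y)))
          (lemma x y)) (go ∣ y - x ∣)
        where
        lemma : ∀ x y → x + (y - x) ≡ y
        lemma = solve-∀
        lemma′ : ∀ x k → x + k + + 1 ≡ x + (+ 1 + k)
        lemma′ = solve-∀
        go : ∀ k → rank x ≤ rank (x + + k)
        go zero    = ℤP.≤-reflexive (cong rank (sym (ℤP.+-identityʳ x)))
        go (suc k) = ℤP.≤-trans (go k) (ℤP.≤-trans (ℤP.i≤i+j (rank (x + + k)) (+ bit (P (x + + k))))
          (ℤP.≤-reflexive (trans (sym (rank-suc (x + + k))) (cong rank (lemma′ x (+ k))))))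

      rank-strict : ∀ {x y} → P x ≡ true → x < y → rank x + + 1 ≤ rank y
      rank-strict {x} {y} Px x<y = subst (_≤ rank y) (rank-suc-true Px) (rank-mono (<⇒1+≤ x<y))

      rank-injective : ∀ {x y} → P x ≡ true → P y ≡ true → rank x ≡ rank y → x ≡ y
      rank-injective {x} {y} Px Py eq with ℤP.<-cmp x y
      ... | tri< x<y _ _ = contradiction eq (ℤP.<⇒≢ (1+≤⇒< (rank-strict Px x<y)))
      ... | tri≈ _ x≡y _ = x≡y
      ... | tri> _ _ y<x = contradiction (sym eq) (ℤP.<⇒≢ (1+≤⇒< (rank-strict Py y<x)))

      Ranked : ℤ → Set
      Ranked q = Σ ℤ λ a → P a ≡ true × rank a ≡ q

      -- A discrete intermediate value argument: `rank` climbs by at most one per step, and the step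
      -- from q to q + 1 happens at an element of `P` whose rank is q.
      ranked-between : ∀ m x q → rank x ≤ q → q < rank (x + + m) → Ranked q
      ranked-between zero    x q lo hi = contradiction (ℤP.<-≤-trans (subst (λ u → q < rank u) (ℤP.+-identityʳ x) hi) lo) ℤP.i≮i
      ranked-between (suc m) x q lo hi with P x in eq | rank x ℤP.≟ q
      ... | true  | yes found = x , eq , found
      ... | true  | no  lo≢   = ranked-between m (x + + 1) q
        (subst (_≤ q) (sym (rank-suc-true eq)) (<⇒1+≤ (ℤP.≤∧≢⇒< lo lo≢))) (subst (λ u → q < rank u) (lemma x (+ m)) hi)
        where
        lemma : ∀ x m → x + (+ 1 + m) ≡ x + + 1 + m
        lemma = solve-∀
      ... | false | _         = ranked-between m (x + + 1) q
        (subst (_≤ q) (sym (rank-suc-false eq)) lo) (subst (λ u → q < rank u) (lemma x (+ m)) hi)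
        where
        lemma : ∀ x m → x + (+ 1 + m) ≡ x + + 1 + m
        lemma = solve-∀

      rank-surjective : ∀ q → Ranked q
      rank-surjective q = ranked-between n x q
        (≤-by-difference ([n/ℕd]*d≤n u l) (trans (cong (λ a → q - a) rank-x) (lemma₁ q (rank (+ 0)) (t * L))))
        (<-by-difference (subst (λ a → u < a * L) (ℤP.+-comm (+ 1) t) (n<s[n/ℕd]*d u l)) (trans (cong (_- q) (trans
            (rank-+N x) (cong (_+ L) rank-x))) (lemma₂ q (rank (+ 0)) t L)))
        where
        -- Division by `l` finds the period, starting at a multiple of n, during which `rank` passes
        -- `q`.
        u = q - rank (+ 0)
        t = u /ℕ l
        x = + 0 + t * N
        rank-x : rank x ≡ rank (+ 0) + t * L
        rank-x = shift-multiple N L rank rank-+N (+ 0) t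
        lemma₁ : ∀ q r v → q - (r + v) ≡ q - r - v
        lemma₁ = solve-∀
        lemma₂ : ∀ q r t l → r + t * l + l - q ≡ (t + + 1) * l - (q - r)
        lemma₂ = solve-∀

    module Involution (z : Bijection) (z-z : ∀ x → to z (to z x) ≡ x) (z-fpf : ∀ x → to z x ≢ x) where

      ζ : ℤ → ℤ
      ζ = to z

      z-multiple : ∀ x t → ζ (x + t * N) ≡ ζ x + t * N
      z-multiple = equivariant-multiple ζ (to-+N z)

      z-injective : ∀ {x y} → ζ x ≡ ζ y → x ≡ y
      z-injective = to-injective z

      -- If `ζ x` were `x + tn`, applying `ζ` again would give x = x + 2tn, so t = 0 and `x` would
      -- be fixed.
      z-not-congruent : ∀ x → ¬ Multiple (ζ x - x)
      z-not-congruent x (t , eq) = z-fpf x (trans (lemma (ζ x) x) (trans (cong (λ u → x + u) (trans eq (cong (_* N) t≡0))) (ℤP.+-identityʳ x)))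
        where
        lemma : ∀ a x → a ≡ x + (a - x)
        lemma = solve-∀
        zx : ζ x ≡ x + t * N
        zx = trans (lemma (ζ x) x) (cong (λ u → x + u) eq)
        x≡ : x ≡ x + t * N + t * N
        x≡ = trans (sym (z-z x)) (trans (cong ζ zx) (trans (z-multiple x t) (cong (_+ t * N) zx)))
        lemma′ : ∀ x u → x + u + u - x ≡ + 2 * u
        lemma′ = solve-∀
        2tN : + 2 * (t * N) ≡ + 2 * + 0
        2tN = trans (sym (lemma′ x (t * N))) (trans (cong (_- x) (sym x≡)) (ℤP.+-inverseʳ x))
        t≡0 : t ≡ + 0
        t≡0 = ℤP.*-cancelʳ-≡ t (+ 0) N (ℤP.*-cancelˡ-≡ (+ 2) (t * N) (+ 0) 2tN)

      second : ℤ → Bool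
      second x = does (ζ x ℤP.<? x)

      second-true : ∀ {x} → ζ x < x → second x ≡ true
      second-true {x} = dec-true (ζ x ℤP.<? x)

      second-false : ∀ {x} → x < ζ x → second x ≡ false
      second-false {x} lt = dec-false (ζ x ℤP.<? x) (ℤP.<-asym lt)

      second-compare : ∀ x → (second x ≡ true × ζ x < x) ⊎ (second x ≡ false × x < ζ x)
      second-compare x with ℤP.<-cmp x (ζ x)
      ... | tri< lt _ _ = inj₂ (second-false lt , lt)
      ... | tri≈ _ eq _ = contradiction (sym eq) (z-fpf x)
      ... | tri> _ _ gt = inj₁ (second-true gt , gt)

      second-z : ∀ x → second (ζ x) ≡ not (second x)
      second-z x with second-compare x
      ... | inj₁ (eq , lt) = trans (second-false (subst (ζ x <_) (sym (z-z x)) lt)) (cong not (sym eq))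
      ... | inj₂ (eq , lt) = trans (second-true (subst (_< ζ x) (sym (z-z x)) lt)) (cong not (sym eq))

      second-+N : ∀ x → second (x + N) ≡ second x
      second-+N x with second-compare x
      ... | inj₁ (eq , lt) = trans (second-true (subst (_< x + N) (sym (to-+N z x)) (ℤP.+-monoˡ-< N lt))) (sym eq)
      ... | inj₂ (eq , lt) = trans (second-false (subst (x + N <_) (sym (to-+N z x)) (ℤP.+-monoˡ-< N lt))) (sym eq)

      -- The cycles of z are listed in the order of their smaller entries when flip is true,
      -- which gives the minimal atom, and of their larger entries otherwise.
      module Atom (flip : Bool) where

        key? : ℤ → Bool
        key? x = flip xor second x

        xor-not : ∀ a b → a xor not b ≡ not (a xor b)
        xor-not true  b = refl
        xor-not false b = refl

        key?-z : ∀ x → key? (ζ x) ≡ not (key? x)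
        key?-z x = trans (cong (flip xor_) (second-z x)) (xor-not flip (second x))

        bit-not : ∀ b → bit b ℕ.+ bit (not b) ≡ 1
        bit-not false = refl
        bit-not true  = refl

        -- Both proofs are arguments of rank, and comparing them unfolded does not terminate in practice.
        opaque
          key?-+N : ∀ x → key? (x + N) ≡ key? x
          key?-+N x = cong (flip xor_) (second-+N x)

          key?-total : ∑ (bit ∘ key?) ≡ l
          key?-total = ℕP.*-cancelʳ-≡ (∑ (bit ∘ key?)) l 2 (begin
            ∑ (bit ∘ key?) ℕ.* 2                              ≡⟨ lemma (∑ (bit ∘ key?)) ⟩
            -- The involution exchanges keys and non-keys, so reindexing one of the two sums by it
            -- makes the summands add up to 1.
            ∑ (bit ∘ key?) ℕ.+ ∑ (bit ∘ key?)                 ≡⟨ cong (∑ (bit ∘ key?) ℕ.+_) (∑-reindex (bit ∘ key?) (cong bit ∘ key?-+N) z) ⟨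
            ∑ (bit ∘ key?) ℕ.+ ∑ (bit ∘ key? ∘ ζ)             ≡⟨ ∑-+ (bit ∘ key?) (bit ∘ key? ∘ ζ) ⟨
            ∑ (λ x → bit (key? x) ℕ.+ bit (key? (ζ x)))       ≡⟨ ∑-cong (λ x → trans (cong (λ b → bit (key? x) ℕ.+ bit b)
                (key?-z x)) (bit-not (key? x))) ⟩
            ∑ (λ _ → 1)                                       ≡⟨ trans (∑-const 1) (ℕP.*-identityʳ n) ⟩
            n                                                 ≡⟨ n≡l*2 ⟩
            l ℕ.* 2                                           ∎)
            where
            open ≡-Reasoning
            lemma : ∀ a → a ℕ.* 2 ≡ a ℕ.+ a
            lemma = ℕS.solve-∀

        open Counting key? key?-+N key?-total

        key : ℤ → ℤ
        key x = if key? x then x else ζ x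

        key-true : ∀ {x} → key? x ≡ true → key x ≡ x
        key-true {x} eq = cong (if_then x else ζ x) eq

        key-false : ∀ {x} → key? x ≡ false → key x ≡ ζ x
        key-false {x} eq = cong (if_then x else ζ x) eq

        key?-key : ∀ x → key? (key x) ≡ true
        key?-key x with key? x in eq
        ... | true  = eq
        ... | false = trans (key?-z x) (cong not eq)

        key-z : ∀ x → key (ζ x) ≡ key x
        key-z x with key? x in eq
        ... | true  = trans (key-false (trans (key?-z x) (cong not eq))) (z-z x)
        ... | false = key-true (trans (key?-z x) (cong not eq))

        key-+N : ∀ x → key (x + N) ≡ key x + N
        key-+N x with key? x in eq
        ... | true  = key-true (trans (key?-+N x) eq)
        ... | false = trans (key-false (trans (key?-+N x) eq)) (to-+N z x)

        -- The cycle whose key has rank q occupies the positions 2q and 2q + 1, its smaller entry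
        -- first for either value of `flip`. Up to a translation, its inverse has the required
        -- window.
        atom : ℤ → ℤ
        atom x = point 0 (rank (key x)) (second x)

        point-injective : ∀ q b r c → point 0 q b ≡ point 0 r c → q ≡ r × b ≡ c
        point-injective q false r false eq = ℤP.*-cancelˡ-≡ (+ 2) q r (trans (lemma q) (trans eq (sym (lemma r)))) , refl
          where
          lemma : ∀ q → + 2 * q ≡ + 0 + (+ 2 * q + + 0)
          lemma = solve-∀
        point-injective q true r true eq = ℤP.*-cancelˡ-≡ (+ 2) q r (trans (lemma q) (trans (cong (_- + 1) eq) (sym (lemma r)))) , refl
          where
          lemma : ∀ q → + 2 * q ≡ + 0 + (+ 2 * q + + 1) - + 1
          lemma = solve-∀
        point-injective q false r true eq = contradiction (trans (lemma r) (trans (sym eq) (lemma′ q))) (odd-not-even r q)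
          where
          lemma : ∀ q → + 2 * q + + 1 ≡ + 0 + (+ 2 * q + + 1)
          lemma = solve-∀
          lemma′ : ∀ q → + 0 + (+ 2 * q + + 0) ≡ + 2 * q
          lemma′ = solve-∀
        point-injective q true r false eq = contradiction (trans (lemma q) (trans eq (lemma′ r))) (odd-not-even q r)
          where
          lemma : ∀ q → + 2 * q + + 1 ≡ + 0 + (+ 2 * q + + 1)
          lemma = solve-∀
          lemma′ : ∀ q → + 0 + (+ 2 * q + + 0) ≡ + 2 * q
          lemma′ = solve-∀

        atom-injective : ∀ {x y} → atom x ≡ atom y → x ≡ y
        atom-injective {x} {y} eq = recover (key? x) (key? y) refl refl
          where
          same : rank (key x) ≡ rank (key y) × second x ≡ second y
          same = point-injective (rank (key x)) (second x) (rank (key y)) (second y) eq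
          same-key : key x ≡ key y
          same-key = rank-injective (key?-key x) (key?-key y) (proj₁ same)
          same-key? : key? x ≡ key? y
          same-key? = cong (flip xor_) (proj₂ same)
          recover : ∀ b c → key? x ≡ b → key? y ≡ c → x ≡ y
          recover true  true  ex ey = trans (sym (key-true ex)) (trans same-key (key-true ey))
          recover false false ex ey = z-injective (trans (sym (key-false ex)) (trans same-key (key-false ey)))
          recover true  false ex ey = contradiction (trans (sym ex) (trans same-key? ey)) λ ()
          recover false true  ex ey = contradiction (trans (sym ex) (trans same-key? ey)) λ ()

        Preimage : ℤ → Set
        Preimage y = Σ ℤ λ x → atom x ≡ y

        -- The key of rank `q` determines the cycle, and exactly one of its two entries has the
        -- prescribed bit.
        point-preimage : ∀ q b → Ranked q → Preimage (point 0 q b)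
        point-preimage q b (a , ka , eq) = choose b (second a) refl
          where
          aim : ∀ b → second a ≡ b → Preimage (point 0 q b)
          aim b eb = a , cong₂ (point 0) (trans (cong rank (key-true ka)) eq) eb
          aim-z : ∀ b → second a ≡ not b → Preimage (point 0 q b)
          aim-z b eb = ζ a , cong₂ (point 0) (trans (cong rank (trans (key-z a) (key-true ka))) eq) (trans (second-z a)
              (trans (cong not eb) (not-involutive b)))
          choose : ∀ b c → second a ≡ c → Preimage (point 0 q b)
          choose false false eb = aim false eb
          choose true  true  eb = aim true eb
          choose false true  eb = aim-z false eb
          choose true  false eb = aim-z true eb

        atom-surjective : ∀ y → Preimage y
        atom-surjective y = let q , b , eq = point-surjective 0 y in
          subst Preimage (sym eq) (point-preimage q b (rank-surjective q))

        atom-+N : Equivariant atom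
        atom-+N x = begin
          point 0 (rank (key (x + N))) (second (x + N))     ≡⟨ cong₂ (point 0) (trans (cong rank (key-+N x)) (rank-+N (key x))) (second-+N x) ⟩
          point 0 (rank (key x) + L) (second x)             ≡⟨ lemma (rank (key x)) L (+ bit (second x)) ⟩
          atom x + L * + 2                                  ≡⟨ cong (λ u → atom x + u) N≡L*2 ⟨
          atom x + N                                        ∎
          where
          open ≡-Reasoning
          lemma : ∀ r l b → + 0 + (+ 2 * (r + l) + b) ≡ + 0 + (+ 2 * r + b) + l * + 2
          lemma = solve-∀

        opaque
          atom⁻¹ : ℤ → ℤ
          atom⁻¹ y = proj₁ (atom-surjective y)

          atom-atom⁻¹ : ∀ y → atom (atom⁻¹ y) ≡ y
          atom-atom⁻¹ y = proj₂ (atom-surjective y)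

        atomᵇ : Bijection
        atomᵇ = record
          { to      = atom
          ; from    = atom⁻¹
          ; from-to = λ x → atom-injective (atom-atom⁻¹ (atom x))
          ; to-from = atom-atom⁻¹
          ; to-+N   = atom-+N
          }

    -- Comparing the length of the involution with that of an atom

    Multiple-neg : ∀ {x} → Multiple x → Multiple (- x)
    Multiple-neg (t , refl) = - t , ℤP.neg-distribˡ-* t N

    D-zero : D (+ 0) ≡ + 0
    D-zero = D-small ℤP.≤-refl (ℤ.+<+ (ℕ.s≤s ℕ.z≤n))

    D-neg : ∀ a → ¬ Multiple a → D (- a) ≡ - D a - + 1
    D-neg a ¬m = D-unique
      (≤-by-difference (ℤP.<⇒≤ (D-upper a)) (lemma₁ a (D a) N))
      (<-by-difference (ℤP.≤∧≢⇒< (D-lower a) (λ eq → ¬m (D a , sym eq))) (lemma₂ a (D a) N))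
      where
      lemma₁ : ∀ a d m → - a - (- d - + 1) * m ≡ (d + + 1) * m - a
      lemma₁ = solve-∀
      lemma₂ : ∀ a d m → (- d - + 1 + + 1) * m - - a ≡ a - d * m
      lemma₂ = solve-∀

    D-nonneg : ∀ {a} → + 0 ≤ a → + 0 ≤ D a
    D-nonneg 0≤a = subst (_≤ D _) D-zero (D-mono 0≤a)

    ∣∣-opposite : ∀ {a b} → + 0 ≤ a → b ≤ + 0 → ∣ a - b ∣ ≡ ∣ a ∣ ℕ.+ ∣ b ∣
    ∣∣-opposite {a} {b} 0≤a b≤0 = ℤP.+-injective (begin
      + ∣ a - b ∣                ≡⟨ ℤP.0≤i⇒+∣i∣≡i (ℤP.i≤j⇒0≤j-i (ℤP.≤-trans b≤0 0≤a)) ⟩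
      a - b                      ≡⟨ cong₂ _+_ (ℤP.0≤i⇒+∣i∣≡i 0≤a) (ℤP.0≤i⇒+∣i∣≡i (ℤP.neg-mono-≤ b≤0)) ⟨
      + ∣ a ∣ + + ∣ - b ∣        ≡⟨ cong (λ u → + ∣ a ∣ + + u) (ℤP.∣-i∣≡∣i∣ b) ⟩
      + ∣ a ∣ + + ∣ b ∣          ∎)
      where open ≡-Reasoning

    ∣∣-opposite′ : ∀ {a b} → a ≤ + 0 → + 0 ≤ b → ∣ a - b ∣ ≡ ∣ a ∣ ℕ.+ ∣ b ∣
    ∣∣-opposite′ {a} {b} a≤0 0≤b = trans (ℤP.∣i-j∣≡∣j-i∣ a b) (trans (∣∣-opposite 0≤b a≤0) (ℕP.+-comm ∣ b ∣ ∣ a ∣))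

    module Length (z : Bijection) (z-z : ∀ x → to z (to z x) ≡ x) (z-fpf : ∀ x → to z x ≢ x) (flip : Bool) where
      open Involution z z-z z-fpf
      open Atom flip
      open Counting key? key?-+N key?-total

      -- The four pairs formed by an entry of the cycle of `x` and one of the cycle of `y`: the
      -- smallest group of terms on which the two lengths can be compared.
      orbitSum : (ℤ → ℤ → ℕ) → ℤ → ℤ → ℕ
      orbitSum F x y = F x y ℕ.+ F (ζ x) y ℕ.+ (F x (ζ y) ℕ.+ F (ζ x) (ζ y))

      ∑∑-orbitSum : ∀ {F} → Biperiodic F → ∑∑ (orbitSum F) ≡ 4 ℕ.* ∑∑ F
      ∑∑-orbitSum {F} per = begin
        ∑∑ (orbitSum F)
          ≡⟨ ∑∑-+ (λ x y → F x y ℕ.+ F (ζ x) y) (λ x y → F x (ζ y) ℕ.+ F (ζ x) (ζ y)) ⟩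
        ∑∑ (λ x y → F x y ℕ.+ F (ζ x) y) ℕ.+ ∑∑ (λ x y → F x (ζ y) ℕ.+ F (ζ x) (ζ y))
          ≡⟨ cong₂ ℕ._+_ (∑∑-+ F (λ x y → F (ζ x) y)) (∑∑-+ (λ x y → F x (ζ y)) (λ x y → F (ζ x) (ζ y))) ⟩
        ∑∑ F ℕ.+ ∑∑ (λ x y → F (ζ x) y) ℕ.+ (∑∑ (λ x y → F x (ζ y)) ℕ.+ ∑∑ (λ x y → F (ζ x) (ζ y)))
          ≡⟨ cong₂ (λ a b → ∑∑ F ℕ.+ a ℕ.+ b) (∑∑-reindex per z idᵇ) (cong₂ ℕ._+_ (∑∑-reindex per idᵇ z) (∑∑-reindex per z z)) ⟩
        ∑∑ F ℕ.+ ∑∑ F ℕ.+ (∑∑ F ℕ.+ ∑∑ F)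
          ≡⟨ lemma (∑∑ F) ⟩
        4 ℕ.* ∑∑ F ∎
        where
        open ≡-Reasoning
        lemma : ∀ a → a ℕ.+ a ℕ.+ (a ℕ.+ a) ≡ 4 ℕ.* a
        lemma = ℕS.solve-∀

      orbitSum-zˡ : ∀ F x y → orbitSum F (ζ x) y ≡ orbitSum F x y
      orbitSum-zˡ F x y = trans (cong (λ u → F (ζ x) y ℕ.+ F u y ℕ.+ (F (ζ x) (ζ y) ℕ.+ F u (ζ y))) (z-z x))
        (cong₂ ℕ._+_ (ℕP.+-comm (F (ζ x) y) (F x y)) (ℕP.+-comm (F (ζ x) (ζ y)) (F x (ζ y))))

      orbitSum-zʳ : ∀ F x y → orbitSum F x (ζ y) ≡ orbitSum F x y
      orbitSum-zʳ F x y = trans (cong (λ u → F x (ζ y) ℕ.+ F (ζ x) (ζ y) ℕ.+ (F x u ℕ.+ F (ζ x) u)) (z-z y))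
        (ℕP.+-comm (F x (ζ y) ℕ.+ F (ζ x) (ζ y)) (F x y ℕ.+ F (ζ x) y))

      orbitSum-multipleʳ : ∀ {F} → Biperiodic F → ∀ x y t → orbitSum F x (y + t * N) ≡ orbitSum F x y
      orbitSum-multipleʳ {F} (_ , perʳ) x y t = cong₂ ℕ._+_
        (cong₂ ℕ._+_ (periodic-multiple N (F x) (perʳ x) y t) (periodic-multiple N (F (ζ x)) (perʳ (ζ x)) y t))
        (cong₂ ℕ._+_ (move x) (move (ζ x)))
        where
        move : ∀ u → F u (ζ (y + t * N)) ≡ F u (ζ y)
        move u = trans (cong (F u) (z-multiple y t)) (periodic-multiple N (F u) (perʳ u) (ζ y) t)

      -- Written to be invariant under `ζ` in both arguments, as orbit sums are. Its total is 2n;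
      -- doubled in `Balanced` and divided by the 4 of `∑∑-orbitSum`, it yields the n in
      -- `‖z‖≡2*‖atom‖+n`.
      sameCycle : ℤ → ℤ → ℕ
      sameCycle x y = χ (y - x) ℕ.+ χ (y - ζ x)

      z-congruent : ∀ {x y} → Multiple (y - x) → Multiple (ζ y - ζ x)
      z-congruent {x} {y} (t , eq) = t , trans (cong (λ u → ζ u - ζ x) y≡) (trans (cong (_- ζ x) (z-multiple x t)) (lemma′ (ζ x) (t * N)))
        where
        lemma : ∀ x y → y ≡ x + (y - x)
        lemma = solve-∀
        lemma′ : ∀ a u → a + u - a ≡ u
        lemma′ = solve-∀
        y≡ : y ≡ x + t * N
        y≡ = trans (lemma x y) (cong (λ u → x + u) eq)

      χ-z : ∀ x y → χ (ζ y - x) ≡ χ (y - ζ x)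
      χ-z x y with multiple? (y - ζ x)
      ... | yes m = trans (χ-yes (subst (λ u → Multiple (ζ y - u)) (z-z x) (z-congruent m))) (sym (χ-yes m))
      ... | no ¬m = trans (χ-no (λ m → ¬m (subst (λ u → Multiple (u - ζ x)) (z-z y) (z-congruent m)))) (sym (χ-no ¬m))

      sameCycle-zˡ : ∀ x y → sameCycle (ζ x) y ≡ sameCycle x y
      sameCycle-zˡ x y = trans (cong (λ u → χ (y - ζ x) ℕ.+ χ (y - u)) (z-z x)) (ℕP.+-comm (χ (y - ζ x)) (χ (y - x)))

      sameCycle-zʳ : ∀ x y → sameCycle x (ζ y) ≡ sameCycle x y
      sameCycle-zʳ x y = trans (cong₂ ℕ._+_ (χ-z x y) (trans (χ-z (ζ x) y) (cong (λ u → χ (y - u)) (z-z x)))) (ℕP.+-comm (χ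
          (y - ζ x)) (χ (y - x)))

      sameCycle-multipleʳ : ∀ x y t → sameCycle x (y + t * N) ≡ sameCycle x y
      sameCycle-multipleʳ x y t = cong₂ ℕ._+_ (move x) (move (ζ x))
        where
        move : ∀ c → χ (y + t * N - c) ≡ χ (y - c)
        move c = periodic-multiple N (λ u → χ (u - c)) (χ-+N c) y t

      ∑∑-sameCycle : ∑∑ sameCycle ≡ n ℕ.* 2
      ∑∑-sameCycle = trans (∑-cong (λ x → trans (∑-+ (λ y → χ (y - x)) (λ y → χ (y - ζ x))) (cong₂ ℕ._+_ (∑χ x) (∑χ (ζ x))))) (∑-const 2)

      e E : ℤ → ℤ → ℕ
      e = gap atom id
      E = gap ζ id

      e-biperiodic : Biperiodic e
      e-biperiodic = gap-biperiodic atom id atom-+N (λ _ → refl)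

      E-biperiodic : Biperiodic E
      E-biperiodic = gap-biperiodic ζ id (to-+N z) (λ _ → refl)

      -- Inversions of z between two cycles are twice those of the atom, with one more
      -- inside each cycle; summing over all pairs gives ℓ(z) = 2 ℓ(atom) + n/2.
      Balanced : ℤ → ℤ → Set
      Balanced x y = orbitSum e x y ℕ.+ orbitSum e x y ℕ.+ (sameCycle x y ℕ.+ sameCycle x y) ≡ orbitSum E x y

      balanced-by : ∀ {x y x′ y′} → (∀ {F} → Biperiodic F → orbitSum F x y ≡ orbitSum F x′ y′) → sameCycle x y ≡ sameCycle x′ y′ →
        Balanced x′ y′ → Balanced x y
      balanced-by orbit cycle b = trans (cong₂ (λ s c → s ℕ.+ s ℕ.+ (c ℕ.+ c)) (orbit e-biperiodic) cycle) (trans b (sym (orbit E-biperiodic)))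

      -- Both sides of `Balanced` are invariant under `ζ` in either argument, so each cycle may be
      -- represented by its key.
      balanced-key : ∀ x y → Balanced (key x) (key y) → Balanced x y
      balanced-key x y b = left (key? x) refl (right (key? y) refl b)
        where
        right : ∀ b → key? y ≡ b → Balanced (key x) (key y) → Balanced (key x) y
        right true  eq = subst (Balanced (key x)) (key-true eq)
        right false eq h = balanced-by (λ {F} _ → sym (orbitSum-zʳ F (key x) y)) (sym (sameCycle-zʳ (key x) y)) (subst
            (Balanced (key x)) (key-false eq) h)
        left : ∀ b → key? x ≡ b → Balanced (key x) y → Balanced x y
        left true  eq = subst (λ u → Balanced u y) (key-true eq)
        left false eq h = balanced-by (λ {F} _ → sym (orbitSum-zˡ F x y)) (sym (sameCycle-zˡ x y)) (subst (λ u → Balanced u y) (key-false eq) h)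

      atom-same-key : ∀ x y → key x ≡ key y → atom y - atom x ≡ + bit (second y) - + bit (second x)
      atom-same-key x y eq = trans (cong (λ k → point 0 (rank k) (second y) - atom x) (sym eq)) (lemma (+ 2 * rank (key x))
          (+ bit (second y)) (+ bit (second x)))
        where
        lemma : ∀ r a b → + 0 + (r + a) - (+ 0 + (r + b)) ≡ a - b
        lemma = solve-∀

      -- The floors of the differences inside the cycle are `d` and `- d - 1`. The atom makes the
      -- entries adjacent, with floors 0 and -1, so both gaps are `q`; the involution exchanges the
      -- two floors, so both gaps are `2q + 1`. The excess of 1 in each direction is the doubled
      -- `sameCycle`.
      balanced-first : ∀ x → second x ≡ false → x < ζ x → Balanced x x
      balanced-first x eq lt = begin
        orbitSum e x x ℕ.+ orbitSum e x x ℕ.+ (sameCycle x x ℕ.+ sameCycle x x) ≡⟨ cong₂ (λ s c → s ℕ.+ s ℕ.+ (c ℕ.+ c)) e-sum cycle ⟩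
        0 ℕ.+ q ℕ.+ (q ℕ.+ 0) ℕ.+ (0 ℕ.+ q ℕ.+ (q ℕ.+ 0)) ℕ.+ 2                 ≡⟨ lemma q ⟩
        0 ℕ.+ (q ℕ.+ q ℕ.+ 1) ℕ.+ ((q ℕ.+ q ℕ.+ 1) ℕ.+ 0)                       ≡⟨ E-sum ⟨
        orbitSum E x x                                                          ∎
        where
        open ≡-Reasoning
        d = D (ζ x - x)
        q = ∣ d ∣
        lemma : ∀ q → 0 ℕ.+ q ℕ.+ (q ℕ.+ 0) ℕ.+ (0 ℕ.+ q ℕ.+ (q ℕ.+ 0)) ℕ.+ 2 ≡ 0 ℕ.+ (q ℕ.+ q ℕ.+ 1) ℕ.+ ((q ℕ.+ q ℕ.+ 1) ℕ.+ 0)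
        lemma = ℕS.solve-∀
        0≤d : + 0 ≤ d
        0≤d = D-nonneg (ℤP.i≤j⇒0≤j-i (ℤP.<⇒≤ lt))
        backwards : D (x - ζ x) ≡ - d - + 1
        backwards = trans (cong D (flipped x (ζ x))) (D-neg (ζ x - x) (z-not-congruent x))
          where
          flipped : ∀ x y → x - y ≡ - (y - x)
          flipped = solve-∀
        gap-diagonal : ∀ f u → gap f id u u ≡ 0
        gap-diagonal f u = cong ∣_∣ (trans (cong₂ (λ a b → D a - D b) (ℤP.+-inverseʳ (f u)) (ℤP.+-inverseʳ u)) (ℤP.+-inverseʳ (D (+ 0))))
        second-ζ : second (ζ x) ≡ true
        second-ζ = trans (second-z x) (cong not eq)
        atom-up : D (atom (ζ x) - atom x) ≡ + 0
        atom-up = trans (cong D (trans (atom-same-key x (ζ x) (sym (key-z x))) (cong₂ (λ a b → + bit a - + bit b) second-ζ eq))) (D-+1 (+ 0))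
        atom-down : D (atom x - atom (ζ x)) ≡ -[1+ 0 ]
        atom-down = trans (cong D (trans (atom-same-key (ζ x) x (key-z x)) (cong₂ (λ a b → + bit a - + bit b) eq second-ζ)))
            (D-below-multiple (+ 0))
        e-up : e x (ζ x) ≡ q
        e-up = trans (cong (λ u → ∣ u - d ∣) atom-up) (trans (cong ∣_∣ (ℤP.+-identityˡ (- d))) (ℤP.∣-i∣≡∣i∣ d))
        e-down : e (ζ x) x ≡ q
        e-down = cong ∣_∣ (trans (cong₂ _-_ atom-down backwards) (lemma′ d))
          where
          lemma′ : ∀ d → -[1+ 0 ] - (- d - + 1) ≡ d
          lemma′ = solve-∀
        e-sum : orbitSum e x x ≡ 0 ℕ.+ q ℕ.+ (q ℕ.+ 0)
        e-sum = cong₂ ℕ._+_ (cong₂ ℕ._+_ (gap-diagonal atom x) e-down) (cong₂ ℕ._+_ e-up (gap-diagonal atom (ζ x)))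
        odd-gap : ∣ d - (- d - + 1) ∣ ≡ q ℕ.+ q ℕ.+ 1
        odd-gap = ℤP.+-injective (trans (ℤP.0≤i⇒+∣i∣≡i (ℤP.≤-trans 0≤d (≤-by-difference (ℤP.≤-trans 0≤d (ℤP.i≤i+j d (+ 1))) (lemma₁ d))))
          (trans (lemma₂ d) (cong (λ u → u + u + + 1) (sym (ℤP.0≤i⇒+∣i∣≡i 0≤d)))))
          where
          lemma₁ : ∀ d → d - (- d - + 1) - d ≡ d + + 1 - + 0
          lemma₁ = solve-∀
          lemma₂ : ∀ d → d - (- d - + 1) ≡ d + d + + 1
          lemma₂ = solve-∀
        E-up : E x (ζ x) ≡ q ℕ.+ q ℕ.+ 1
        E-up = trans (cong (λ u → ∣ D (u - ζ x) - d ∣) (z-z x)) (trans (cong (λ u → ∣ u - d ∣) backwards) (trans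
            (ℤP.∣i-j∣≡∣j-i∣ (- d - + 1) d) odd-gap))
        E-down : E (ζ x) x ≡ q ℕ.+ q ℕ.+ 1
        E-down = trans (cong (λ u → ∣ D (ζ x - u) - D (x - ζ x) ∣) (z-z x)) (trans (cong (λ u → ∣ d - u ∣) backwards) odd-gap)
        E-sum : orbitSum E x x ≡ 0 ℕ.+ (q ℕ.+ q ℕ.+ 1) ℕ.+ ((q ℕ.+ q ℕ.+ 1) ℕ.+ 0)
        E-sum = cong₂ ℕ._+_ (cong₂ ℕ._+_ (gap-diagonal ζ x) E-down) (cong₂ ℕ._+_ E-up (gap-diagonal ζ (ζ x)))
        cycle : sameCycle x x ≡ 1
        cycle = cong₂ ℕ._+_ (χ-yes (Multiple-0 (ℤP.+-inverseʳ x))) (χ-no (λ m → z-not-congruent x (Multiple-by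
            (Multiple-neg m) (flipped x (ζ x)))))
          where
          flipped : ∀ x y → y - x ≡ - (x - y)
          flipped = solve-∀

      balanced-diagonal : ∀ x → Balanced x x
      balanced-diagonal x with second-compare x
      ... | inj₂ (eq , lt) = balanced-first x eq lt
      ... | inj₁ (eq , lt) = balanced-by
        (λ {F} _ → trans (sym (orbitSum-zˡ F x x)) (sym (orbitSum-zʳ F (ζ x) x)))
        (trans (sym (sameCycle-zˡ x x)) (sym (sameCycle-zʳ (ζ x) x)))
        (balanced-first (ζ x) (trans (second-z x) (cong not eq)) (subst (ζ x <_) (sym (z-z x)) lt))

      -- Distinct cycles occupy disjoint blocks of two consecutive values of the atom.
      atom-block-order : ∀ {x y} → rank (key x) + + 1 ≤ rank (key y) → rank (key y) + + 1 ≤ rank (key x) + L → D (atom y - atom x) ≡ + 0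
      atom-block-order {x} {y} lo hi = D-small
        (ℤP.≤-trans (ℤ.+≤+ (ℕ.z≤n {1})) (≤-by-difference (ℤP.+-mono-≤ (ℤP.+-mono-≤ lo lo) (ℤP.+-mono-≤ (bit≤1 (second x)) (0≤bit (second y))))
          (lemma₁ (rank (key x)) (rank (key y)) (+ bit (second x)) (+ bit (second y)))))
        (1+≤⇒< (≤-by-difference (ℤP.+-mono-≤ (ℤP.+-mono-≤ hi hi) (ℤP.+-mono-≤ (0≤bit (second x)) (bit≤1 (second y))))
          (trans (cong (_- (atom y - atom x + + 1)) N≡L*2) (lemma₂ (rank (key x)) (rank (key y)) (+ bit (second x)) (+ bit (second y)) L))))
        where
        bit≤1 : ∀ b → + bit b ≤ + 1
        bit≤1 false = ℤ.+≤+ ℕ.z≤n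
        bit≤1 true  = ℤ.+≤+ (ℕ.s≤s ℕ.z≤n)
        0≤bit : ∀ b → + 0 ≤ + bit b
        0≤bit b = ℤ.+≤+ ℕ.z≤n
        lemma₁ : ∀ r s b c → + 0 + (+ 2 * s + c) - (+ 0 + (+ 2 * r + b)) - + 1 ≡ s + s + (+ 1 + c) - (r + + 1 + (r + + 1) + (b + + 0))
        lemma₁ = solve-∀
        lemma₂ : ∀ r s b c l → l * + 2 - (+ 0 + (+ 2 * s + c) - (+ 0 + (+ 2 * r + b)) + + 1) ≡ r + l + (r + l) + (b + + 1) -
            (s + + 1 + (s + + 1) + (+ 0 + c))
        lemma₂ = solve-∀

      -- The atom puts the block of `x` before that of `y` within one period, so its floors vanish
      -- and its gaps are the absolute floors of the original differences. For the involution, the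
      -- keys are both smaller or both larger entries, so `D (ζ y - x)` and `D (y - ζ x)` lie on
      -- opposite sides of `D (y - x)`, which is 0; hence the absolute value of their difference
      -- splits as `q + r`.
      balanced-separate : ∀ x y → key? x ≡ true → key? y ≡ true → x < y → y < x + N → Balanced x y
      balanced-separate x y kx ky x<y y<x+N = begin
        orbitSum e x y ℕ.+ orbitSum e x y ℕ.+ (sameCycle x y ℕ.+ sameCycle x y) ≡⟨ cong₂ (λ s c → s ℕ.+ s ℕ.+ (c ℕ.+ c)) e-sum cycle ⟩
        0 ℕ.+ r ℕ.+ (q ℕ.+ s) ℕ.+ (0 ℕ.+ r ℕ.+ (q ℕ.+ s)) ℕ.+ 0                 ≡⟨ lemma q r s ⟩
        s ℕ.+ (q ℕ.+ r) ℕ.+ (q ℕ.+ r ℕ.+ s)                                     ≡⟨ E-sum ⟨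
        orbitSum E x y                                                          ∎
        where
        open ≡-Reasoning
        q r s : ℕ
        q = ∣ D (ζ y - x) ∣
        r = ∣ D (y - ζ x) ∣
        s = ∣ D (ζ y - ζ x) ∣
        lemma : ∀ q r s → 0 ℕ.+ r ℕ.+ (q ℕ.+ s) ℕ.+ (0 ℕ.+ r ℕ.+ (q ℕ.+ s)) ℕ.+ 0 ≡ s ℕ.+ (q ℕ.+ r) ℕ.+ (q ℕ.+ r ℕ.+ s)
        lemma = ℕS.solve-∀
        difference-< : y - x < N
        difference-< = <-by-difference y<x+N (lemma′ x y N)
          where
          lemma′ : ∀ x y m → m - (y - x) ≡ x + m - y
          lemma′ = solve-∀
        difference-> : + 0 < y - x
        difference-> = <-by-difference x<y (ℤP.+-identityʳ (y - x))
        D-y-x : D (y - x) ≡ + 0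
        D-y-x = D-small (ℤP.<⇒≤ difference->) difference-<
        rank-lo : rank x + + 1 ≤ rank y
        rank-lo = rank-strict kx x<y
        rank-hi : rank y + + 1 ≤ rank x + L
        rank-hi = subst (rank y + + 1 ≤_) (rank-+N x) (rank-strict ky y<x+N)
        block : ∀ {u v} → key u ≡ x → key v ≡ y → e u v ≡ ∣ D (v - u) ∣
        block {u} {v} eu ev = trans (cong (λ d → ∣ d - D (v - u) ∣) (atom-block-order {u} {v}
            (subst₂ (λ a b → rank a + + 1 ≤ rank b) (sym eu) (sym ev) rank-lo)
            (subst₂ (λ a b → rank b + + 1 ≤ rank a + L) (sym eu) (sym ev) rank-hi)))
          (trans (cong ∣_∣ (ℤP.+-identityˡ (- D (v - u)))) (ℤP.∣-i∣≡∣i∣ (D (v - u))))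
        kzx : key (ζ x) ≡ x
        kzx = trans (key-z x) (key-true kx)
        kzy : key (ζ y) ≡ y
        kzy = trans (key-z y) (key-true ky)
        e-sum : orbitSum e x y ≡ 0 ℕ.+ r ℕ.+ (q ℕ.+ s)
        e-sum = cong₂ ℕ._+_
          (cong₂ ℕ._+_ (trans (block (key-true kx) (key-true ky)) (cong ∣_∣ D-y-x)) (block kzx (key-true ky)))
          (cong₂ ℕ._+_ (block (key-true kx) kzy) (block kzx kzy))
        mono : ∀ {a b c d} → a ≤ b → d ≤ c → D (a - c) ≤ D (b - d)
        mono a≤b d≤c = D-mono (ℤP.+-mono-≤ a≤b (ℤP.neg-mono-≤ d≤c))
        key?⇒second : ∀ {u} → key? u ≡ true → second u ≡ not flip
        key?⇒second {u} eq = recover flip (second u) eq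
          where
          recover : ∀ a b → a xor b ≡ true → b ≡ not a
          recover true  false _ = refl
          recover false true  _ = refl
        opposite : ∀ b → second x ≡ b → second y ≡ b → ∣ D (ζ y - x) - D (y - ζ x) ∣ ≡ q ℕ.+ r
        opposite false sx sy = ∣∣-opposite
          (subst (_≤ D (ζ y - x)) D-y-x (mono (ℤP.<⇒≤ (above sy)) ℤP.≤-refl))
          (subst (D (y - ζ x) ≤_) D-y-x (mono {y} ℤP.≤-refl (ℤP.<⇒≤ (above sx))))
          where
          above : ∀ {u} → second u ≡ false → u < ζ u
          above {u} eq with second-compare u
          ... | inj₁ (eq′ , _) = contradiction (trans (sym eq) eq′) λ ()
          ... | inj₂ (_ , lt)  = lt
        opposite true sx sy = ∣∣-opposite′
          (subst (D (ζ y - x) ≤_) D-y-x (mono (ℤP.<⇒≤ (below sy)) ℤP.≤-refl))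
          (subst (_≤ D (y - ζ x)) D-y-x (mono {y} ℤP.≤-refl (ℤP.<⇒≤ (below sx))))
          where
          below : ∀ {u} → second u ≡ true → ζ u < u
          below {u} eq with second-compare u
          ... | inj₁ (_ , lt)  = lt
          ... | inj₂ (eq′ , _) = contradiction (trans (sym eq) eq′) λ ()
        crossing : ∣ D (ζ y - x) - D (y - ζ x) ∣ ≡ q ℕ.+ r
        crossing = opposite (not flip) (key?⇒second kx) (key?⇒second ky)
        E-sum : orbitSum E x y ≡ s ℕ.+ (q ℕ.+ r) ℕ.+ (q ℕ.+ r ℕ.+ s)
        E-sum = cong₂ ℕ._+_
          (cong₂ ℕ._+_ (trans (cong (λ d → ∣ D (ζ y - ζ x) - d ∣) D-y-x) (cong ∣_∣ (ℤP.+-identityʳ (D (ζ y - ζ x)))))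
                       (trans (cong (λ u → ∣ D (ζ y - u) - D (y - ζ x) ∣) (z-z x)) crossing))
          (cong₂ ℕ._+_ (trans (cong (λ u → ∣ D (u - ζ x) - D (ζ y - x) ∣) (z-z y)) (trans (ℤP.∣i-j∣≡∣j-i∣ (D (y - ζ x)) (D (ζ y - x))) crossing))
                       (trans (cong₂ (λ u v → ∣ D (u - v) - D (ζ y - ζ x) ∣) (z-z y) (z-z x))
                         (trans (cong (λ d → ∣ d - D (ζ y - ζ x) ∣) D-y-x) (trans (cong ∣_∣ (ℤP.+-identityˡ (- D
                             (ζ y - ζ x)))) (ℤP.∣-i∣≡∣i∣ (D (ζ y - ζ x)))))))
        cycle : sameCycle x y ≡ 0
        cycle = cong₂ ℕ._+_ (χ-no (small-not-multiple difference-> difference-<)) (χ-no different)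
          where
          different : ¬ Multiple (y - ζ x)
          different (t , eq) = contradiction (trans (sym ky) (trans (cong key? (trans (lemma′ (ζ x) y) (cong (λ u → ζ x + u) eq)))
              (trans (periodic-multiple N key? key?-+N (ζ x) t) (trans (key?-z x) (cong not kx))))) λ ()
            where
            lemma′ : ∀ a y → y ≡ a + (y - a)
            lemma′ = solve-∀

      balanced-near : ∀ x y → key? x ≡ true → key? y ≡ true → x ≤ y → y < x + N → Balanced x y
      balanced-near x y kx ky x≤y y<x+N with x ℤP.≟ y
      ... | yes refl = balanced-diagonal x
      ... | no  x≢y  = balanced-separate x y kx ky (ℤP.≤∧≢⇒< x≤y x≢y) y<x+N

      -- After passing to keys, the second one is shifted by a multiple of n into the period that
      -- starts at the first.
      balanced : ∀ x y → Balanced x y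
      balanced x y = balanced-key x y (balanced-by
          (λ per → sym (orbitSum-multipleʳ per a b t)) (sym (sameCycle-multipleʳ a b t))
          (balanced-near a (b + t * N) (key?-key x) (trans (periodic-multiple N key? key?-+N b t) (key?-key y))
            (≤-by-difference (D-lower (b - a)) (lemma₁ a b (D (b - a)) N))
            (<-by-difference (D-upper (b - a)) (lemma₂ a b (D (b - a)) N))))
        where
        a = key x
        b = key y
        t = - D (b - a)
        lemma₁ : ∀ a b d m → b + (- d) * m - a ≡ b - a - d * m
        lemma₁ = solve-∀
        lemma₂ : ∀ a b d m → a + m - (b + (- d) * m) ≡ (d + + 1) * m - (b - a)
        lemma₂ = solve-∀

      ‖z‖≡2*‖atom‖+n : ‖ z ‖ ≡ 2 ℕ.* ‖ atomᵇ ‖ ℕ.+ n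
      ‖z‖≡2*‖atom‖+n = ℕP.*-cancelˡ-≡ ‖ z ‖ (2 ℕ.* ‖ atomᵇ ‖ ℕ.+ n) 4 (begin
        4 ℕ.* ∑∑ E                                                                   ≡⟨ ∑∑-orbitSum E-biperiodic ⟨
        ∑∑ (orbitSum E)                                                              ≡⟨ ∑∑-cong balanced ⟨
        ∑∑ (λ x y → orbitSum e x y ℕ.+ orbitSum e x y ℕ.+ (sameCycle x y ℕ.+ sameCycle x y))
          ≡⟨ ∑∑-+ (λ x y → orbitSum e x y ℕ.+ orbitSum e x y) (λ x y → sameCycle x y ℕ.+ sameCycle x y) ⟩
        ∑∑ (λ x y → orbitSum e x y ℕ.+ orbitSum e x y) ℕ.+ ∑∑ (λ x y → sameCycle x y ℕ.+ sameCycle x y)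
          ≡⟨ cong₂ ℕ._+_ (∑∑-+ (orbitSum e) (orbitSum e)) (∑∑-+ sameCycle sameCycle) ⟩
        ∑∑ (orbitSum e) ℕ.+ ∑∑ (orbitSum e) ℕ.+ (∑∑ sameCycle ℕ.+ ∑∑ sameCycle)
          ≡⟨ cong₂ (λ a b → a ℕ.+ a ℕ.+ (b ℕ.+ b)) (∑∑-orbitSum e-biperiodic) ∑∑-sameCycle ⟩
        4 ℕ.* ∑∑ e ℕ.+ 4 ℕ.* ∑∑ e ℕ.+ (n ℕ.* 2 ℕ.+ n ℕ.* 2)                          ≡⟨ lemma (∑∑ e) n ⟩
        4 ℕ.* (2 ℕ.* ∑∑ e ℕ.+ n)                                                     ∎)
        where
        open ≡-Reasoning
        lemma : ∀ a m → 4 ℕ.* a ℕ.+ 4 ℕ.* a ℕ.+ (m ℕ.* 2 ℕ.+ m ℕ.* 2) ≡ 4 ℕ.* (2 ℕ.* a ℕ.+ m)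
        lemma = ℕS.solve-∀

    -- Atoms of drift zero: conjugation and windows

    from-unique : ∀ f x y → to f x ≡ y → from f y ≡ x
    from-unique f x y eq = trans (cong (from f) (sym eq)) (from-to f x)

    intertwines⇒conjugates : ∀ c w z → (∀ x → Θ c (to w x) ≡ to w (to z x)) → Conjugates c w z
    intertwines⇒conjugates c w z intertwines x = from-unique w (to z x) (Θ c (to w x)) (sym (intertwines x))

    module Normalised (z : Bijection) (z-z : ∀ x → to z (to z x) ≡ x) (z-fpf : ∀ x → to z x ≢ x) (flip : Bool) where
      open Involution z z-z z-fpf
      open Atom flip
      open Counting key? key?-+N key?-total
      open Length z z-z z-fpf flip using (‖z‖≡2*‖atom‖+n)

      opaque
        -- By `drift-displacement` the drift of the atom is n times this sum of window
        -- displacements, and translating by c adds n times c, so the drift cancels exactly.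
        offset : ℤ
        offset = - ℤ∑.∑ (λ x → D (atom x - + 1))

        offset-unfold : offset ≡ - ℤ∑.∑ (λ x → D (atom x - + 1))
        offset-unfold = refl

      α : Bijection
      α = translate offset ∘ᵇ atomᵇ

      drift-α : drift (to α) ≡ + 0
      drift-α = trans (drift-+ atom offset) (trans (cong₂ (λ a c → a + N * c) (drift-displacement atomᵇ) offset-unfold)
          (lemma (ℤ∑.∑ (λ x → D (atom x - + 1))) N))
        where
        lemma : ∀ s m → s * m + m * (- s) ≡ + 0
        lemma = solve-∀

      ‖α‖ : ‖ α ‖ ≡ ‖ atomᵇ ‖
      ‖α‖ = ∑∑-cong (λ x y → cong (λ u → ∣ D u - D (y - x) ∣) (lemma (atom y) (atom x) offset))
        where
        lemma : ∀ a b c → a + c - (b + c) ≡ a - b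
        lemma = solve-∀

      ‖z‖≡2*‖α‖+n : ‖ z ‖ ≡ 2 ℕ.* ‖ α ‖ ℕ.+ n
      ‖z‖≡2*‖α‖+n = trans ‖z‖≡2*‖atom‖+n (cong (λ a → 2 ℕ.* a ℕ.+ n) (sym ‖α‖))

      α-z : ∀ x → to α (ζ x) ≡ point 0 (rank (key x)) (not (second x)) + offset
      α-z x = cong (_+ offset) (cong₂ (point 0) (cong rank (key-z x)) (second-z x))

      -- The translated blocks coincide with those of `Θ c`, renumbered by `d`. Both `Θ c` and the
      -- involution then keep the block and negate the bit.
      conjugates-at : ∀ c d → offset ≡ + c + + 2 * d → Conjugates c α z
      conjugates-at c d eq = intertwines⇒conjugates c α z λ x → begin
        Θ c (to α x)                                            ≡⟨ cong (Θ c) (shift (rank (key x)) (second x)) ⟩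
        Θ c (point c (rank (key x) + d) (second x))             ≡⟨ Θ-point c (rank (key x) + d) (second x) ⟩
        point c (rank (key x) + d) (not (second x))             ≡⟨ shift (rank (key x)) (not (second x)) ⟨
        point 0 (rank (key x)) (not (second x)) + offset        ≡⟨ α-z x ⟨
        to α (ζ x)                                              ∎
        where
        open ≡-Reasoning
        lemma : ∀ r b c d → + 0 + (+ 2 * r + b) + (c + + 2 * d) ≡ c + (+ 2 * (r + d) + b)
        lemma = solve-∀
        shift : ∀ r b → point 0 r b + offset ≡ point c (r + d) b
        shift r b = trans (cong (λ u → point 0 r b + u) eq) (lemma r (+ bit b) (+ c) d)

      -- The parity of `offset` decides: odd gives Θ⁺, even gives Θ⁻.
      conjugates : Conjugates 1 α z ⊎ Conjugates 2 α z
      conjugates = choose (point-surjective 1 offset)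
        where
        lemma₁ : ∀ u → + 1 + (u + + 0) ≡ + 1 + u
        lemma₁ = solve-∀
        lemma₂ : ∀ u → + 1 + (u + + 1) ≡ + 2 + u
        lemma₂ = solve-∀
        choose : (Σ ℤ λ d → Σ Bool λ b → offset ≡ point 1 d b) → Conjugates 1 α z ⊎ Conjugates 2 α z
        choose (d , false , eq) = inj₁ (conjugates-at 1 d (trans eq (lemma₁ (+ 2 * d))))
        choose (d , true  , eq) = inj₂ (conjugates-at 2 d (trans eq (lemma₂ (+ 2 * d))))

      -- Ranks must be consecutive for the two-element blocks to fill a contiguous stretch of the
      -- window.
      data Enumerates : ℤ → List ℕ → Set where
        []  : ∀ {q} → Enumerates q []
        _∷_ : ∀ {q a as} → key? (+ a) ≡ true × rank (+ a) ≡ q → Enumerates (q + + 1) as → Enumerates q (a ∷ as)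

      -- While scanning consecutive integers, `rank` advances exactly at the entries that the filter
      -- keeps.
      enumerates-filter : ∀ {P : ℕ → Set} (P? : Decidable P) → (∀ a → key? (+ a) ≡ does (P? a)) →
        ∀ m f → (∀ i → f (suc i) ≡ suc (f i)) → Enumerates (rank (+ f 0)) (filter P? (applyUpTo f m))
      enumerates-filter P? agrees zero    f consecutive = []
      enumerates-filter P? agrees (suc m) f consecutive with does (P? (f 0)) | agrees (f 0)
      ... | true  | ka = (ka , refl) ∷ subst (λ q → Enumerates q (filter P? (applyUpTo (f ∘ suc) m)))
        (trans (cong rank step) (rank-suc-true ka)) (enumerates-filter P? agrees m (f ∘ suc) (consecutive ∘ suc))
        where
        step : + f 1 ≡ + f 0 + + 1
        step = cong +_ (trans (consecutive 0) (ℕP.+-comm 1 (f 0)))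
      ... | false | ka = subst (λ q → Enumerates q (filter P? (applyUpTo (f ∘ suc) m)))
        (trans (cong rank step) (rank-suc-false ka)) (enumerates-filter P? agrees m (f ∘ suc) (consecutive ∘ suc))
        where
        step : + f 1 ≡ + f 0 + + 1
        step = cong +_ (trans (consecutive 0) (ℕP.+-comm 1 (f 0)))

      from-α : ∀ u a b → key u ≡ + a × second u ≡ b → from α (point 0 (rank (+ a)) b + offset) ≡ u
      from-α u a b (eq , eq′) = from-unique α u (point 0 (rank (+ a)) b + offset) to-α
        where
        to-α : to α u ≡ point 0 (rank (+ a)) b + offset
        to-α = cong₂ (λ r c → point 0 r c + offset) (cong rank eq) eq′

      -- The functions `g` and `h` give the two entries of a block in terms of its key: the key and
      -- its image for the minimal atom, the image and the key for the maximal one.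
      module Window (v : ℤ → ℤ) (g h : ℕ → ℤ)
        (v-first  : ∀ a → key? (+ a) ≡ true → v (point 0 (rank (+ a)) false + offset) ≡ g a)
        (v-second : ∀ a → key? (+ a) ≡ true → v (point 0 (rank (+ a)) true + offset) ≡ h a) where

        window : ∀ {q as} → Enumerates q as → ∀ (k : Fin (length (concatMap (λ a → g a ∷ h a ∷ []) as))) →
          v (offset - + 1 + + 2 * q + + suc (toℕ k)) ≡ lookup (concatMap (λ a → g a ∷ h a ∷ []) as) k
        window (_∷_ {q} {a} (ka , refl) _) Fin.zero = trans (cong (v) (lemma offset q)) (v-first a ka)
          where
          lemma : ∀ o q → o - + 1 + + 2 * q + + 1 ≡ + 0 + (+ 2 * q + + 0) + o
          lemma = solve-∀
        window (_∷_ {q} {a} (ka , refl) _) (Fin.suc Fin.zero) = trans (cong (v) (lemma offset q)) (v-second a ka)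
          where
          lemma : ∀ o q → o - + 1 + + 2 * q + + 2 ≡ + 0 + (+ 2 * q + + 1) + o
          lemma = solve-∀
        window (_∷_ {q} _ enum) (Fin.suc (Fin.suc k)) = trans (cong (v) (lemma offset q (+ toℕ k))) (window enum k)
          where
          lemma : ∀ o q k → o - + 1 + + 2 * q + (+ 3 + k) ≡ o - + 1 + + 2 * (q + + 1) + (+ 1 + k)
          lemma = solve-∀

        hasWindow : ∀ {P : ℕ → Set} (P? : Decidable P) → (∀ a → key? (+ a) ≡ does (P? a)) →
          HasWindow (v) (concatMap (λ a → g a ∷ h a ∷ []) (filter P? (map suc (upTo n))))
        hasWindow P? agrees = subst (λ as → HasWindow (v) (concatMap (λ a → g a ∷ h a ∷ []) (filter P? as))) (sym (ListP.map-upTo suc n))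
          -- The first key at or after 1 has rank `rank (+ 1)`; the shift is one less than the start
          -- of its block because window positions count from 1.
          (offset - + 1 + + 2 * rank (+ 1) , window (enumerates-filter P? agrees n suc (λ _ → refl)))

    -- Minimality of the atoms and the common length

    module Theorem (z : AffPerm n) (z-inv : IsFPFInvolution z) where

      zᵇ : Bijection
      zᵇ = bijection z

      z-z : ∀ x → fun z (fun z x) ≡ x
      z-z x = proj₁ (z-inv x)

      z-fpf : ∀ x → fun z x ≢ x
      z-fpf x = proj₂ (z-inv x)

      open Involution zᵇ z-z z-fpf

      module Extremal (flip : Bool) where
        open Normalised zᵇ z-z z-fpf flip public
        open Atom flip public using (key?; key; key-true; key-z)

        αᵃ : AffPerm n
        αᵃ = affPerm α drift-α

        -- The bound `‖conjugate‖` is an equality for `α`, so `2 ‖ α ‖ + n` is at most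
        -- `2 ‖ w ‖ + n`, whichever Θ is conjugated by `w`.
        shortest : ∀ c (w : AffPerm n) → Conjugates c (bijection w) zᵇ → ‖ α ‖ ℕ.≤ ‖ bijection w ‖
        shortest c w conj = ℕP.*-cancelˡ-≤ 2 (ℕP.+-cancelʳ-≤ n (2 ℕ.* ‖ α ‖) (2 ℕ.* ‖ bijection w ‖)
          (ℕP.≤-trans (ℕP.≤-reflexive (sym ‖z‖≡2*‖α‖+n)) (‖conjugate‖ c (bijection w) zᵇ conj)))

        minConj : ∀ c → Conjugates c α zᵇ → MinConj n (Θ c) z αᵃ
        minConj c conj = conj , proj₁ lengthα , proj₂ lengthα , λ w conj-w k hasLen →
          ℕP.*-cancelˡ-≤ 2 (subst₂ ℕ._≤_ (HasLength⇒‖‖ α drift-α (proj₁ lengthα) (proj₂ lengthα)) (HasLength⇒‖‖ (bijection w)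
              (drift-fun w) k hasLen)
            (shortest c w conj-w))
          where
          lengthα = has-length α drift-α

      module αₘᵢₙ = Extremal true
      module αₘₐₓ = Extremal false

      -- The atom is at most as long as `w` by `shortest`, and at least as long by minimality of
      -- `w`, which speaks about the atom only if it conjugates the same `Θ c`.
      minConj-length : ∀ c (w : AffPerm n) → Conjugates c αₘᵢₙ.α zᵇ → MinConj n (Θ c) z w →
        Σ ℕ λ k → HasLength n (fun w) k × HasLength n (fun z) (2 ℕ.* k ℕ.+ l)
      minConj-length c w conj-α (conj-w , k , hasLen , minimal) = k , hasLen ,
        ‖‖⇒HasLength zᵇ (drift-fun z) (2 ℕ.* k ℕ.+ l) (begin
          ‖ zᵇ ‖                              ≡⟨ αₘᵢₙ.‖z‖≡2*‖α‖+n ⟩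
          2 ℕ.* ‖ αₘᵢₙ.α ‖ ℕ.+ n              ≡⟨ cong₂ (λ a b → 2 ℕ.* a ℕ.+ b) ‖α‖≡2k n≡l*2 ⟩
          2 ℕ.* (2 ℕ.* k) ℕ.+ l ℕ.* 2         ≡⟨ lemma k l ⟩
          2 ℕ.* (2 ℕ.* k ℕ.+ l)               ∎)
        where
        open ≡-Reasoning
        lemma : ∀ k l → 2 ℕ.* (2 ℕ.* k) ℕ.+ l ℕ.* 2 ≡ 2 ℕ.* (2 ℕ.* k ℕ.+ l)
        lemma = ℕS.solve-∀
        lengthα = has-length αₘᵢₙ.α αₘᵢₙ.drift-α
        ‖α‖≡2k : ‖ αₘᵢₙ.α ‖ ≡ 2 ℕ.* k
        ‖α‖≡2k = ℕP.≤-antisym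
          (ℕP.≤-trans (αₘᵢₙ.shortest c w conj-w) (ℕP.≤-reflexive (HasLength⇒‖‖ (bijection w) (drift-fun w) k hasLen)))
          (ℕP.≤-trans (ℕP.*-monoʳ-≤ 2 (minimal αₘᵢₙ.αᵃ conj-α (proj₁ lengthα) (proj₂ lengthα)))
            (ℕP.≤-reflexive (sym (HasLength⇒‖‖ αₘᵢₙ.α αₘᵢₙ.drift-α (proj₁ lengthα) (proj₂ lengthα)))))

      atoms-length : ∀ (w : AffPerm n) → MinConj n (Θ 1) z w ⊎ MinConj n (Θ 2) z w →
        Σ ℕ λ k → HasLength n (fun w) k × HasLength n (fun z) (2 ℕ.* k ℕ.+ l)
      atoms-length w = decide αₘᵢₙ.conjugates
        where
        decide : Conjugates 1 αₘᵢₙ.α zᵇ ⊎ Conjugates 2 αₘᵢₙ.α zᵇ → MinConj n (Θ 1) z w ⊎ MinConj n (Θ 2) z w →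
          Σ ℕ λ k → HasLength n (fun w) k × HasLength n (fun z) (2 ℕ.* k ℕ.+ l)
        decide (inj₁ conj) (inj₁ min) = minConj-length 1 w conj min
        decide (inj₂ conj) (inj₂ min) = minConj-length 2 w conj min
        -- In the mixed cases minimality of `w` says nothing about the atom, so they are ruled out
        -- by the non-conjugacy of Θ⁺ and Θ⁻.
        decide (inj₁ conj) (inj₂ min) = contradiction (proj₁ min) (not-conjugate-to-both αₘᵢₙ.α (bijection w) zᵇ αₘᵢₙ.drift-α (drift-fun w) conj)
        decide (inj₂ conj) (inj₁ min) = contradiction conj (not-conjugate-to-both (bijection w) αₘᵢₙ.α zᵇ (drift-fun w) αₘᵢₙ.drift-α (proj₁ min))

      α-isAtom : ∀ flip → MinConj n (Θ 1) z (Extremal.αᵃ flip) ⊎ MinConj n (Θ 2) z (Extremal.αᵃ flip)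
      α-isAtom flip = Sum.map (Extremal.minConj flip 1) (Extremal.minConj flip 2) (Extremal.conjugates flip)

      αₘᵢₙ-window : IsαMin z αₘᵢₙ.αᵃ
      αₘᵢₙ-window = αₘᵢₙ.Window.hasWindow (inv αₘᵢₙ.αᵃ) +_ (λ a → fun z (+ a))
        (λ a ka → αₘᵢₙ.from-α (+ a) a false (αₘᵢₙ.key-true ka , flipped ka))
        (λ a ka → αₘᵢₙ.from-α (fun z (+ a)) a true (trans (αₘᵢₙ.key-z (+ a)) (αₘᵢₙ.key-true ka) , trans (second-z (+ a))
            (cong not (flipped ka))))
        (λ a → + a ℤP.<? fun z (+ a)) agrees
        where
        flipped : ∀ {x} → not (second x) ≡ true → second x ≡ false
        flipped {x} eq = trans (sym (not-involutive (second x))) (cong not eq)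
        agrees : ∀ a → not (second (+ a)) ≡ does (+ a ℤP.<? fun z (+ a))
        agrees a with second-compare (+ a)
        ... | inj₁ (eq , lt) = trans (cong not eq) (sym (dec-false (+ a ℤP.<? fun z (+ a)) (ℤP.<-asym lt)))
        ... | inj₂ (eq , lt) = trans (cong not eq) (sym (dec-true (+ a ℤP.<? fun z (+ a)) lt))

      αₘₐₓ-window : IsαMax z αₘₐₓ.αᵃ
      αₘₐₓ-window = αₘₐₓ.Window.hasWindow (inv αₘₐₓ.αᵃ) (λ d → fun z (+ d)) +_
        (λ d kd → αₘₐₓ.from-α (fun z (+ d)) d false (trans (αₘₐₓ.key-z (+ d)) (αₘₐₓ.key-true kd) , trans (second-z (+ d)) (cong not kd)))
        (λ d kd → αₘₐₓ.from-α (+ d) d true (αₘₐₓ.key-true kd , kd))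
        -- With `flip` false, `key?` unfolds to the very test by which `dList` filters.
        (λ d → fun z (+ d) ℤP.<? + d) (λ _ → refl)

theorem3p6 : (n : ℕ) → 2 ℕ.≤ n → 2 ∣ n → (z : AffPerm n) → IsFPFInvolution z →
    ((w : AffPerm n) → InAFPF n z w → Σ ℕ λ k → HasLength n (fun w) k × HasHatLengthFPF n z k)
    × (Σ (AffPerm n) λ w → IsαMin z w × InAFPF n z w)
    × (Σ (AffPerm n) λ w → IsαMax z w × InAFPF n z w)
theorem3p6 (suc (suc p)) _ (divides l n≡l*2) z z-inv =
  atoms-length , (αₘᵢₙ.αᵃ , αₘᵢₙ-window , α-isAtom true) , (αₘₐₓ.αᵃ , αₘₐₓ-window , α-isAtom false)
  where
  n = suc (suc p)
  -- The quotient `l` is replaced by `n / 2` so that `Θ 1`, `Θ 2` and the length `2k + l` agree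
  -- definitionally with `Θ⁺`, `Θ⁻` and `HasHatLengthFPF`.
  n≡[n/2]*2 : n ≡ n ℕ./ 2 ℕ.* 2
  n≡[n/2]*2 = trans n≡l*2 (cong (ℕ._* 2) (sym (trans (cong (ℕ._/ 2) n≡l*2) (m*n/n≡m l 2))))
  open Affine.Even.Theorem p (n ℕ./ 2) n≡[n/2]*2 z z-inv
theorem3p6 (suc zero) (ℕ.s≤s ())
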